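{- For every nonnegative integer $n$ and every integer $\alpha\ge 2$, $$\overline{A}_{5^\alpha}(25n)\equiv \overline{A}_{5^{\alpha+2}}(625n) \pmod{5}.$$
   Context: An overpartition of $n$ is a partition of $n$ in which the first occurrence of each distinct part may be overlined. For a positive integer $\ell$, $\overline{A}_\ell(n)$ denotes the number of overpartitions of $n$ into parts not divisible by $\ell$, with $\overline{A}_\ell(0)=1$; equivalently $$\sum_{n\ge 0}\overline{A}_\ell(n)q^n=\frac{(q^\ell;q^\ell)_\infty^2(q^2;q^2)_\infty}{(q;q)_\infty^2(q^{2\ell};q^{2\ell})_\infty},\qquad (a;q)_\infty=\prod_{k\ge 0}(1-aq^k).$$ -}

module Defs where

open import Data.Nat using (ℕ; zero; suc; _+_; _*_; _∸_; _≤?_)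
open import Data.Nat.Divisibility using (_∣?_)
open import Data.Bool using (Bool; true; false)
open import Data.Product using (_×_; _,_)
open import Data.List using (List; []; _∷_; _++_; map; concatMap; replicate; length; upTo)
open import Relation.Nullary using (yes; no)

-- A part of an overpartition: (size , overlined?)
Part : Set
Part = ℕ × Bool

-- An overpartition is represented as the list of its parts in non-increasing
-- order of size, where only the first occurrence of a size may be overlined.
Overpartition : Set
Overpartition = List Part

block : ℕ → ℕ → Bool → List Part
block k m b = (k , b) ∷ replicate (m ∸ 1) (k , false)

-- overparts ℓ n k : the list of ALL overpartitions of n whose parts are
-- all ≤ k and not divisible by ℓ (each listed exactly once).
-- Built by choosing the multiplicity m of the largest allowed size (suc k)
-- and, when m ≥ 1, whether its first occurrence is overlined.
overparts : ℕ → ℕ → ℕ → List Overpartition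
overparts ℓ zero    zero    = [] ∷ []
overparts ℓ (suc n) zero    = []
overparts ℓ n       (suc k) with ℓ ∣? suc k
... | yes _ = overparts ℓ n k
... | no  _ = overparts ℓ n k ++ concatMap choose (upTo (suc n))
  where
  withMult : ℕ → List Overpartition
  withMult m with m * suc k ≤? n
  ... | no  _ = []
  ... | yes _ =
        map (block (suc k) m true  ++_) (overparts ℓ (n ∸ m * suc k) k)
     ++ map (block (suc k) m false ++_) (overparts ℓ (n ∸ m * suc k) k)
  choose : ℕ → List Overpartition
  choose zero    = []
  choose (suc m) = withMult (suc m)

-- Ā_ℓ(n): number of overpartitions of n into parts not divisible by ℓ.
-- (All parts of an overpartition of n are ≤ n.)  Ā_ℓ(0) = 1.
Abar : ℕ → ℕ → ℕ
Abar ℓ n = length (overparts ℓ n n)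

{-# OPTIONS --safe #-}

-- All series are taken modulo 5, so f(q⁵) = f(q)⁵. Put θ = φ(-q) = ∑ (-1)ʲ q^(j²) and
-- ℓ = 5^α. Gauss' identity φ(-q) = ∏ (1 - qⁱ)/(1 + qⁱ) turns the generating function F of
-- Ā_ℓ into φ(-q^ℓ)/φ(-q), that is F θ = θ^ℓ. Let U (∑ aₙ qⁿ) = ∑ a₅ₙ qⁿ, so that
-- U (f⁵ g) = f · U g. In the dissection θ = a(q⁵) + q b(q⁵) + q⁴ c(q⁵) one has a = θ⁵, and the
-- relation r₂(5n) + r₂(n/5) = 2 r₂(n) for sums of two squares determines q b c. This
-- gives U θ⁴ = θ⁴ and U³ θ³ = U θ³. Hence U F = θ^(5^(α-1)) θ³ and
-- U² F = θ^(5^(α-2)) U θ³, while U⁴ of the series for 5^(α+2) is θ^(5^(α-2)) U³ θ³.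
module Submission where

open import Defs
open import Algebra.Bundles using (CommutativeSemiring; RawRing)
import Algebra.Properties.Semiring.Exp as Exp
import Algebra.Properties.Semiring.Mult.TCOptimised as TCOptimised
import Algebra.Solver.Ring
open import Algebra.Solver.Ring.AlmostCommutativeRing
  using (_-Raw-AlmostCommutative⟶_; fromCommutativeSemiring)
open import Algebra.Structures using (IsCommutativeMonoid)
open import Algebra.Structures.Biased using (isCommutativeSemiringˡ)
open import Data.Bool using (true)
open import Data.Integer using (ℤ; -[1+_]; ∣_∣)
import Data.Integer as ℤ
open import Data.Integer.Divisibility.Signed using (divides; ∣ᵤ⇒∣; ∣⇒∣ᵤ)
  renaming (_∣_ to _∣ℤ_; _∣?_ to _∣ℤ?_)
import Data.Integer.Properties as ℤ
open import Data.Integer.Tactic.RingSolver using (solve-∀)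
open import Data.List
  using (List; []; _∷_; _++_; map; concat; length; applyUpTo; filter; cartesianProduct)
open import Data.List.Membership.Propositional using (_∈_)
open import Data.List.Membership.Propositional.Properties
  using (∈-map⁺; ∈-map⁻; ∈-filter⁺; ∈-filter⁻; ∈-cartesianProduct⁺)
open import Data.List.Membership.Propositional.Properties.WithK using (unique∧set⇒bag)
open import Data.List.Properties
  using (length-++; length-map; filter-≐; filter-none; filter-accept; filter-reject)
open import Data.List.Relation.Binary.BagAndSetEquality using (∼bag⇒↭)
open import Data.List.Relation.Binary.Permutation.Propositional.Properties using (↭-length)
import Data.List.Relation.Unary.All as All
open import Data.List.Relation.Unary.AllPairs using ([]; _∷_)
open import Data.List.Relation.Unary.Any using (here; there)
open import Data.List.Relation.Unary.Unique.Propositional using (Unique)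
import Data.List.Relation.Unary.Unique.Propositional.Properties as Unique
open import Data.Maybe using (Maybe; just; nothing)
open import Data.Nat
  using (ℕ; zero; suc; _∸_; _^_; _%_; _/_; _≤_; _<_; _≤?_; z≤n; s≤s; s≤s⁻¹; NonZero)
import Data.Nat as ℕ
open import Data.Nat.Divisibility using (_∣_; _∣?_; ∣m+n∣m⇒∣n; >⇒∤; n∣m*n)
  renaming (divides to ℕ-divides)
open import Data.Nat.DivMod
  using (m≡m%n+[m/n]*n; %-distribˡ-+; %-distribˡ-*; [m+kn]%n≡m%n; m%n<n; m<n⇒m%n≡m)
open import Data.Nat.Primality using (Prime; prime?; euclidsLemma)
import Data.Nat.Properties as ℕ
open import Data.Product using (Σ; ∃; ∃₂; _,_; proj₁; proj₂)
open import Data.Sum using (_⊎_; inj₁; inj₂)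
open import Function using (id; _∘_)
open import Function.Bundles using (mk⇔)
import Relation.Binary.Reasoning.Setoid as SetoidReasoning
open import Relation.Binary.PropositionalEquality as ≡ using (_≡_; cong; cong₂)
open import Relation.Binary.Structures using (IsEquivalence)
open import Relation.Nullary using (¬_; yes; no; contradiction)
open import Relation.Nullary.Decidable using (from-yes)
open import Relation.Unary using (Decidable)
open import Relation.Unary.Properties using (_∩?_; _∪?_)

-- The obstacle is the denominator of F = θ^ℓ / θ, since U is only linear. Writing 1/θ as θ^4 / θ^5
-- makes the denominator a fifth power, which passes through U as θ; this is why U θ^4 is needed. A
-- monomial (a^5)^i (q b^5)^j (q^4 c^5)^k contributes to U only if j = k modulo 5, so for degree at
-- most 4 only a and q b c survive. The relation for r₂ amounts to a^2 + q b c = θ^2, and modulo 5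
-- the multinomial coefficients 6 and 12 become 1 and 2, which turns the remaining expressions into
-- a (a^2 + q b c) and (a^2 + q b c)^2. No infinite product, inverse series or substitution of q^5
-- for q is formed. Coefficients are natural numbers compared modulo 5, a fifth power stands for the
-- substitution, limits are replaced by agreement up to degree n, and division by cancellation of a
-- series with constant term 1. Gauss' identity comes from a finite identity whose recurrence
-- telescopes.

module PowerSeries {c ℓ} (R : CommutativeSemiring c ℓ) where
  open CommutativeSemiring R

  Series : Set c
  Series = ℕ → Carrier

  infix 4 _≋_
  -- A record instead of the bare pointwise statement, so that unification can recover `f` and `g`
  -- from the type.
  record _≋_ (f g : Series) : Set ℓ where
    constructor pointwise
    field at : ∀ n → f n ≈ g n
  open _≋_ public

  infixl 6 _⊕_
  infixl 7 _⊛_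

  tail : Series → Series
  tail f n = f (suc n)

  shift : Series → Series
  shift f zero    = 0#
  shift f (suc n) = f n

  const : Carrier → Series
  const a zero    = a
  const a (suc n) = 0#

  X : Series
  X = shift (const 1#)

  _⊕_ : Series → Series → Series
  (f ⊕ g) n = f n + g n

  -- The Cauchy product, obtained from f = f 0 + X · tail f by recursion on the degree, so that no
  -- finite sums have to be manipulated.
  _⊛_ : Series → Series → Series
  (f ⊛ g) zero    = f 0 * g 0
  (f ⊛ g) (suc n) = f 0 * g (suc n) + (tail f ⊛ g) n

  open SetoidReasoning setoid

  +-swap : ∀ a b c d → (a + b) + (c + d) ≈ (a + c) + (b + d)
  +-swap a b c d = begin
    (a + b) + (c + d)  ≈⟨ +-assoc a b (c + d) ⟩
    a + (b + (c + d))  ≈⟨ +-congˡ (+-assoc b c d) ⟨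
    a + ((b + c) + d)  ≈⟨ +-congˡ (+-congʳ (+-comm b c)) ⟩
    a + ((c + b) + d)  ≈⟨ +-congˡ (+-assoc c b d) ⟩
    a + (c + (b + d))  ≈⟨ +-assoc a c (b + d) ⟨
    (a + c) + (b + d)  ∎

  -- Stronger than congruence: it also makes agreement up to degree n compatible with products.
  ⊛-cong-≤ : ∀ {f f′ g g′} n → (∀ i → i ≤ n → f i ≈ f′ i) → (∀ i → i ≤ n → g i ≈ g′ i) →
             (f ⊛ g) n ≈ (f′ ⊛ g′) n
  ⊛-cong-≤ zero    f≈ g≈ = *-cong (f≈ 0 z≤n) (g≈ 0 z≤n)
  ⊛-cong-≤ (suc n) f≈ g≈ = +-cong (*-cong (f≈ 0 z≤n) (g≈ (suc n) ℕ.≤-refl))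
    (⊛-cong-≤ n (λ i i≤n → f≈ (suc i) (s≤s i≤n)) (λ i i≤n → g≈ i (ℕ.m≤n⇒m≤1+n i≤n)))

  zeroˡ-⊛ : ∀ g n → (const 0# ⊛ g) n ≈ 0#
  tail-const : ∀ a g n → (tail (const a) ⊛ g) n ≈ 0#

  tail-const a g zero    = zeroˡ _
  tail-const a g (suc n) = trans (+-cong (zeroˡ _) (tail-const 0# g n)) (+-identityˡ _)

  zeroˡ-⊛ g zero    = zeroˡ _
  zeroˡ-⊛ g (suc n) = trans (+-cong (zeroˡ _) (tail-const 0# g n)) (+-identityˡ _)

  const-⊛ : ∀ a g n → (const a ⊛ g) n ≈ a * g n
  const-⊛ a g zero    = refl
  const-⊛ a g (suc n) = trans (+-congˡ (tail-const a g n)) (+-identityʳ _)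

  shift-⊛ : ∀ f g n → (shift f ⊛ g) n ≈ shift (f ⊛ g) n
  shift-⊛ f g zero    = zeroˡ _
  shift-⊛ f g (suc n) = trans (+-congʳ (zeroˡ _)) (+-identityˡ _)

  distribʳ-⊛ : ∀ f g h n → ((g ⊕ h) ⊛ f) n ≈ (g ⊛ f) n + (h ⊛ f) n
  distribʳ-⊛ f g h zero    = distribʳ _ _ _
  distribʳ-⊛ f g h (suc n) = begin
    (g 0 + h 0) * f (suc n) + (tail (g ⊕ h) ⊛ f) n
      ≈⟨ +-cong (distribʳ _ _ _) (distribʳ-⊛ f (tail g) (tail h) n) ⟩
    (g 0 * f (suc n) + h 0 * f (suc n)) + ((tail g ⊛ f) n + (tail h ⊛ f) n)
      ≈⟨ +-swap _ _ _ _ ⟩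
    (g 0 * f (suc n) + (tail g ⊛ f) n) + (h 0 * f (suc n) + (tail h ⊛ f) n)  ∎

  -- The mirror image of the defining recursion, splitting the head off the second factor;
  -- commutativity plays the two against each other.
  ⊛-suc : ∀ f g n → (f ⊛ g) (suc n) ≈ (f ⊛ tail g) n + f (suc n) * g 0
  ⊛-suc f g zero    = refl
  ⊛-suc f g (suc n) = trans (+-congˡ (⊛-suc (tail f) g n)) (sym (+-assoc _ _ _))

  ⊛-comm : ∀ f g n → (f ⊛ g) n ≈ (g ⊛ f) n
  ⊛-comm f g zero    = *-comm _ _
  ⊛-comm f g (suc n) = begin
    f 0 * g (suc n) + (tail f ⊛ g) n  ≈⟨ +-cong (*-comm _ _) (⊛-comm (tail f) g n) ⟩
    g (suc n) * f 0 + (g ⊛ tail f) n  ≈⟨ +-comm _ _ ⟩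
    (g ⊛ tail f) n + g (suc n) * f 0  ≈⟨ ⊛-suc g f n ⟨
    (g ⊛ f) (suc n)                   ∎

  scale-⊛ : ∀ a g h n → ((λ i → a * g i) ⊛ h) n ≈ a * (g ⊛ h) n
  scale-⊛ a g h zero    = *-assoc _ _ _
  scale-⊛ a g h (suc n) = begin
    (a * g 0) * h (suc n) + ((λ i → a * g (suc i)) ⊛ h) n
      ≈⟨ +-cong (*-assoc _ _ _) (scale-⊛ a (tail g) h n) ⟩
    a * (g 0 * h (suc n)) + a * (tail g ⊛ h) n
      ≈⟨ distribˡ _ _ _ ⟨
    a * (g 0 * h (suc n) + (tail g ⊛ h) n)  ∎

  ⊛-assoc : ∀ f g h n → ((f ⊛ g) ⊛ h) n ≈ (f ⊛ (g ⊛ h)) n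
  ⊛-assoc f g h zero    = *-assoc _ _ _
  ⊛-assoc f g h (suc n) = begin
    (f 0 * g 0) * h (suc n) + (((λ i → f 0 * g (suc i)) ⊕ (tail f ⊛ g)) ⊛ h) n
      ≈⟨ +-cong (*-assoc _ _ _) (distribʳ-⊛ h _ _ n) ⟩
    f 0 * (g 0 * h (suc n)) + (((λ i → f 0 * g (suc i)) ⊛ h) n + ((tail f ⊛ g) ⊛ h) n)
      ≈⟨ +-congˡ (+-cong (scale-⊛ (f 0) (tail g) h n) (⊛-assoc (tail f) g h n)) ⟩
    f 0 * (g 0 * h (suc n)) + (f 0 * (tail g ⊛ h) n + (tail f ⊛ (g ⊛ h)) n)
      ≈⟨ +-assoc _ _ _ ⟨
    (f 0 * (g 0 * h (suc n)) + f 0 * (tail g ⊛ h) n) + (tail f ⊛ (g ⊛ h)) n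
      ≈⟨ +-congʳ (distribˡ _ _ _) ⟨
    f 0 * (g 0 * h (suc n) + (tail g ⊛ h) n) + (tail f ⊛ (g ⊛ h)) n  ∎

  ≋-isEquivalence : IsEquivalence _≋_
  ≋-isEquivalence = record
    { refl  = pointwise λ _ → refl
    ; sym   = λ p → pointwise λ n → sym (at p n)
    ; trans = λ p q → pointwise λ n → trans (at p n) (at q n)
    }

  const0≈0 : ∀ n → const 0# n ≈ 0#
  const0≈0 zero    = refl
  const0≈0 (suc n) = refl

  ⊕-isCommutativeMonoid : IsCommutativeMonoid _≋_ _⊕_ (const 0#)
  ⊕-isCommutativeMonoid = record
    { isMonoid = record
      { isSemigroup = record
        { isMagma = record
          { isEquivalence = ≋-isEquivalence
          ; ∙-cong        = λ p q → pointwise λ n → +-cong (at p n) (at q n)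
          }
        ; assoc = λ f g h → pointwise λ n → +-assoc _ _ _
        }
      ; identity = (λ f → pointwise λ n → trans (+-congʳ (const0≈0 n)) (+-identityˡ _))
                 , (λ f → pointwise λ n → trans (+-congˡ (const0≈0 n)) (+-identityʳ _))
      }
    ; comm = λ f g → pointwise λ n → +-comm _ _
    }

  ⊛-isCommutativeMonoid : IsCommutativeMonoid _≋_ _⊛_ (const 1#)
  ⊛-isCommutativeMonoid = record
    { isMonoid = record
      { isSemigroup = record
        { isMagma = record
          { isEquivalence = ≋-isEquivalence
          ; ∙-cong        = λ p q → pointwise λ n →
                              ⊛-cong-≤ n (λ i _ → at p i) (λ i _ → at q i)
          }
        ; assoc = λ f g h → pointwise (⊛-assoc f g h)
        }
      ; identity = (λ f → pointwise λ n → trans (const-⊛ 1# f n) (*-identityˡ _))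
                 , (λ f → pointwise λ n → trans (⊛-comm f (const 1#) n)
                                          (trans (const-⊛ 1# f n) (*-identityˡ _)))
      }
    ; comm = λ f g → pointwise (⊛-comm f g)
    }

  commutativeSemiring : CommutativeSemiring c ℓ
  commutativeSemiring = record
    { isCommutativeSemiring = isCommutativeSemiringˡ record
      { +-isCommutativeMonoid = ⊕-isCommutativeMonoid
      ; *-isCommutativeMonoid = ⊛-isCommutativeMonoid
      ; distribʳ = λ f g h → pointwise (distribʳ-⊛ f g h)
      ; zeroˡ    = λ g → pointwise λ n → trans (zeroˡ-⊛ g n) (sym (const0≈0 n))
      }
    }

-- The coefficients of the solver are the residues modulo 5, so that the numeral
-- 4 plays the role of -1 and no negation is needed.
module Characteristic5 {c ℓ} (R : CommutativeSemiring c ℓ)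
  (char5 : CommutativeSemiring._≈_ R
    (TCOptimised._×_ (CommutativeSemiring.semiring R) 5 (CommutativeSemiring.1# R))
    (CommutativeSemiring.0# R)) where

  private
    open CommutativeSemiring R
    open TCOptimised semiring
    open SetoidReasoning setoid

    ×-zeroʳ : ∀ n → n × 0# ≈ 0#
    ×-zeroʳ n = trans (×-congʳ n (sym char5)) (trans (×-assocˡ 1# n 5) (lemma n))
      where
      lemma : ∀ n → (n ℕ.* 5) × 1# ≈ 0#
      lemma zero    = refl
      lemma (suc n) = trans (×-homo-+ 1# 5 (n ℕ.* 5)) (trans (+-cong char5 (lemma n)) (+-identityˡ 0#))

    ×-%5 : ∀ m → (m % 5) × 1# ≈ m × 1#
    ×-%5 m = begin
      (m % 5) × 1#                         ≈⟨ +-identityʳ _ ⟨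
      (m % 5) × 1# + 0#                    ≈⟨ +-congˡ (×-zeroʳ (m / 5)) ⟨
      (m % 5) × 1# + (m / 5) × 0#          ≈⟨ +-congˡ (×-congʳ (m / 5) char5) ⟨
      (m % 5) × 1# + (m / 5) × (5 × 1#)    ≈⟨ +-congˡ (×-assocˡ 1# (m / 5) 5) ⟩
      (m % 5) × 1# + (m / 5 ℕ.* 5) × 1#    ≈⟨ ×-homo-+ 1# (m % 5) (m / 5 ℕ.* 5) ⟨
      (m % 5 ℕ.+ m / 5 ℕ.* 5) × 1#         ≡⟨ cong (_× 1#) (m≡m%n+[m/n]*n m 5) ⟨
      m × 1#                               ∎

    residues : RawRing _ _
    residues = record
      { Carrier = ℕ
      ; _≈_     = _≡_
      ; _+_     = λ m n → (m ℕ.+ n) % 5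
      ; _*_     = λ m n → (m ℕ.* n) % 5
      -- This agrees with the negation that `fromCommutativeSemiring` supplies; the solved equations
      -- contain none.
      ; -_      = id
      ; 0#      = 0
      ; 1#      = 1
      }

    homomorphism : residues -Raw-AlmostCommutative⟶ fromCommutativeSemiring R
    homomorphism = record
      { ⟦_⟧    = _× 1#
      ; +-homo = λ m n → trans (×-%5 (m ℕ.+ n)) (×-homo-+ 1# m n)
      ; *-homo = λ m n → trans (×-%5 (m ℕ.* n)) (×1-homo-* m n)
      ; -‿homo = λ _ → refl
      ; 0-homo = refl
      ; 1-homo = refl
      }

    ×-dec : ∀ m n → Maybe (m × 1# ≈ n × 1#)
    ×-dec m n with m ℕ.≟ n
    ... | no _  = nothing
    ... | yes p = just (reflexive (cong (_× 1#) p))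

  open Algebra.Solver.Ring residues (fromCommutativeSemiring R) homomorphism ×-dec public
    using (solve; _:=_; _:+_; _:*_; _:^_; con)

-- Series over 𝔽₅

open import Data.Nat using (_+_; _*_)
open import Data.Product using (_×_)

infix 4 _≈₅_
-- Wrapped in a record because a bare equation between remainders computes and thereby hides `x` and
-- `y` from unification.
record _≈₅_ (x y : ℕ) : Set where
  constructor mod5
  field %5≡ : x % 5 ≡ y % 5
open _≈₅_

≡⇒≈₅ : ∀ {x y} → x ≡ y → x ≈₅ y
≡⇒≈₅ p = mod5 (cong (_% 5) p)

+-cong₅ : ∀ {x y u v} → x ≈₅ y → u ≈₅ v → x + u ≈₅ y + v
+-cong₅ {x} {y} {u} {v} (mod5 p) (mod5 q) = mod5 (begin
  (x + u) % 5          ≡⟨ %-distribˡ-+ x u 5 ⟩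
  (x % 5 + u % 5) % 5  ≡⟨ cong₂ (λ a b → (a + b) % 5) p q ⟩
  (y % 5 + v % 5) % 5  ≡⟨ %-distribˡ-+ y v 5 ⟨
  (y + v) % 5          ∎)
  where open ≡.≡-Reasoning

*-cong₅ : ∀ {x y u v} → x ≈₅ y → u ≈₅ v → x * u ≈₅ y * v
*-cong₅ {x} {y} {u} {v} (mod5 p) (mod5 q) = mod5 (begin
  (x * u) % 5              ≡⟨ %-distribˡ-* x u 5 ⟩
  ((x % 5) * (u % 5)) % 5  ≡⟨ cong₂ (λ a b → (a * b) % 5) p q ⟩
  ((y % 5) * (v % 5)) % 5  ≡⟨ %-distribˡ-* y v 5 ⟨
  (y * v) % 5              ∎)
  where open ≡.≡-Reasoning

≈₅-isEquivalence : IsEquivalence _≈₅_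
≈₅-isEquivalence = record
  { refl  = mod5 ≡.refl
  ; sym   = λ p → mod5 (≡.sym (%5≡ p))
  ; trans = λ p q → mod5 (≡.trans (%5≡ p) (%5≡ q))
  }

ℤ/5 : CommutativeSemiring _ _
ℤ/5 = record
  { isCommutativeSemiring = isCommutativeSemiringˡ record
    { +-isCommutativeMonoid = record
      { isMonoid = record
        { isSemigroup = record
          { isMagma = record { isEquivalence = ≈₅-isEquivalence ; ∙-cong = +-cong₅ }
          ; assoc   = λ x y z → ≡⇒≈₅ (ℕ.+-assoc x y z)
          }
        ; identity = (λ _ → mod5 ≡.refl) , (λ x → ≡⇒≈₅ (ℕ.+-identityʳ x))
        }
      ; comm = λ x y → ≡⇒≈₅ (ℕ.+-comm x y)
      }
    ; *-isCommutativeMonoid = record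
      { isMonoid = record
        { isSemigroup = record
          { isMagma = record { isEquivalence = ≈₅-isEquivalence ; ∙-cong = *-cong₅ }
          ; assoc   = λ x y z → ≡⇒≈₅ (ℕ.*-assoc x y z)
          }
        ; identity = (λ x → ≡⇒≈₅ (ℕ.*-identityˡ x)) , (λ x → ≡⇒≈₅ (ℕ.*-identityʳ x))
        }
      ; comm = λ x y → ≡⇒≈₅ (ℕ.*-comm x y)
      }
    ; distribʳ = λ x y z → ≡⇒≈₅ (ℕ.*-distribʳ-+ x y z)
    ; zeroˡ    = λ _ → mod5 ≡.refl
    }
  }

module 𝔽 = CommutativeSemiring ℤ/5
module 𝔽-Solver = Characteristic5 ℤ/5 (mod5 ≡.refl)

open PowerSeries ℤ/5

module 𝕊 = CommutativeSemiring commutativeSemiring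
open Exp 𝕊.semiring
  using (^-congˡ; ^-congʳ; ^-homo-*; ^-assocʳ) renaming (_^_ to infixr 8 _^ˢ_)

char5 : TCOptimised._×_ 𝕊.semiring 5 𝕊.1# ≋ 𝕊.0#
char5 = pointwise λ { zero → mod5 ≡.refl ; (suc n) → mod5 ≡.refl }

module 𝕊-Solver = Characteristic5 commutativeSemiring char5
open TCOptimised 𝕊.semiring using () renaming (_×_ to infixr 8 _×ˢ_)

open import Algebra.Properties.CommutativeSemiring.Exp commutativeSemiring using (^-distrib-*)

module ≋-Reasoning = SetoidReasoning 𝕊.setoid
module ≈₅-Reasoning = SetoidReasoning 𝔽.setoid

+-cancelˡ-≈₅ : ∀ x {y z} → x + y ≈₅ x + z → y ≈₅ z
+-cancelˡ-≈₅ x {y} {z} p = begin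
  y                ≈⟨ lemma y ⟨
  4 * x + (x + y)  ≈⟨ +-cong₅ (𝔽.refl {4 * x}) p ⟩
  4 * x + (x + z)  ≈⟨ lemma z ⟩
  z                ∎
  where
  open ≈₅-Reasoning
  open 𝔽-Solver
  lemma : ∀ w → 4 * x + (x + w) ≈₅ w
  lemma w = solve 2 (λ x w → con 4 :* x :+ (x :+ w) := w) 𝔽.refl x w

open Exp 𝔽.semiring using () renaming (_^_ to infixr 8 _^₅_; ^-assocʳ to ^₅-assocʳ)

-- Induction on x: the solver reduces coefficients modulo 5, so (1 + x)^5 = 1 + x^5 is a plain ring
-- identity for it.
fermat : ∀ x → x ^₅ 5 ≈₅ x
fermat zero    = mod5 ≡.refl
fermat (suc x) = 𝔽.trans
  (solve 1 (λ x → (con 1 :+ x) :^ 5 := con 1 :+ x :^ 5) 𝔽.refl x)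
  (+-cong₅ (𝔽.refl {1}) (fermat x))
  where open 𝔽-Solver

1^ : ∀ n → 𝕊.1# ^ˢ n ≋ 𝕊.1#
1^ zero    = 𝕊.refl
1^ (suc n) = 𝕊.trans (𝕊.*-identityˡ _) (1^ n)

X⊛ : ∀ f n → (X ⊛ f) n ≈₅ shift f n
X⊛ f zero    = mod5 ≡.refl
X⊛ f (suc n) = 𝔽.trans (shift-⊛ (const 1) f (suc n))
  (𝔽.trans (const-⊛ 1 f n) (𝔽.*-identityˡ (f n)))

X^⊛-zero : ∀ k f {i} → i < k → (X ^ˢ k ⊛ f) i ≈₅ 0
X^⊛-suc : ∀ k f i → (X ^ˢ suc k ⊛ f) i ≈₅ shift (X ^ˢ k ⊛ f) i
X^⊛-suc k f i = 𝔽.trans (at (𝕊.*-assoc X (X ^ˢ k) f) i) (X⊛ (X ^ˢ k ⊛ f) i)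
X^⊛-zero (suc k) f {zero}  _       = X^⊛-suc k f 0
X^⊛-zero (suc k) f {suc i} (s≤s p) = 𝔽.trans (X^⊛-suc k f (suc i)) (X^⊛-zero k f p)

X^⊛-+ : ∀ k f i → (X ^ˢ k ⊛ f) (k + i) ≈₅ f i
X^⊛-+ zero    f i = at (𝕊.*-identityˡ f) i
X^⊛-+ (suc k) f i = 𝔽.trans (X^⊛-suc k f (suc k + i)) (X^⊛-+ k f i)

const-^ : ∀ a k → const a ^ˢ k ≋ const (a ^₅ k)
const-^ a zero    = 𝕊.refl
const-^ a (suc k) = 𝕊.trans (𝕊.*-congˡ (const-^ a k))
  (pointwise λ { zero    → 𝔽.refl
               ; (suc n) → 𝔽.trans (const-⊛ a _ (suc n)) (𝔽.zeroʳ a) })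

uncons : ∀ f → f ≋ const (f 0) ⊕ X ⊛ tail f
uncons f = pointwise λ
  { zero    → 𝔽.sym (𝔽.trans (𝔽.+-congˡ {f 0} (X⊛ (tail f) 0)) (𝔽.+-identityʳ (f 0)))
  ; (suc n) → 𝔽.sym (X⊛ (tail f) (suc n))
  }

-- The recursive form of f(q)^5 = f(q^5). It yields all coefficients of a fifth power, five degrees
-- at a time.
frobenius-uncons : ∀ f → f ^ˢ 5 ≋ const (f 0) ⊕ X ^ˢ 5 ⊛ tail f ^ˢ 5
frobenius-uncons f = begin
  f ^ˢ 5                                   ≈⟨ ^-congˡ 5 (uncons f) ⟩
  (const (f 0) ⊕ X ⊛ tail f) ^ˢ 5
    ≈⟨ solve 3 (λ a x t → (a :+ x :* t) :^ 5 := a :^ 5 :+ x :^ 5 :* t :^ 5) 𝕊.refl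
         (const (f 0)) X (tail f) ⟩
  const (f 0) ^ˢ 5 ⊕ X ^ˢ 5 ⊛ tail f ^ˢ 5  ≈⟨ 𝕊.+-congʳ const-fermat ⟩
  const (f 0) ⊕ X ^ˢ 5 ⊛ tail f ^ˢ 5       ∎
  where
  open ≋-Reasoning
  open 𝕊-Solver
  const-fermat : const (f 0) ^ˢ 5 ≋ const (f 0)
  const-fermat = 𝕊.trans (const-^ (f 0) 5)
    (pointwise λ { zero → fermat (f 0) ; (suc n) → 𝔽.refl })

frobenius-5∣ : ∀ f n → (f ^ˢ 5) (n * 5) ≈₅ f n
frobenius-5∣ f zero = 𝔽.trans (at (frobenius-uncons f) 0)
  (𝔽.trans (𝔽.+-congˡ {f 0} (X^⊛-zero 5 (tail f ^ˢ 5) (s≤s z≤n))) (𝔽.+-identityʳ (f 0)))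
frobenius-5∣ f (suc n) = 𝔽.trans (at (frobenius-uncons f) (5 + n * 5))
  (𝔽.trans (X^⊛-+ 5 (tail f ^ˢ 5) (n * 5)) (frobenius-5∣ (tail f) n))

frobenius-5∤ : ∀ f r n → r < 4 → (f ^ˢ 5) (suc r + n * 5) ≈₅ 0
frobenius-5∤ f r zero r<4 = 𝔽.trans (at (frobenius-uncons f) (suc r + 0))
  (X^⊛-zero 5 (tail f ^ˢ 5) (s≤s (≡.subst (_< 4) (≡.sym (ℕ.+-identityʳ r)) r<4)))
frobenius-5∤ f r (suc n) r<4 = begin
  (f ^ˢ 5) (suc r + suc n * 5)                   ≈⟨ ≡⇒≈₅ (cong (f ^ˢ 5) eq) ⟩
  (f ^ˢ 5) (5 + (suc r + n * 5))                 ≈⟨ at (frobenius-uncons f) (5 + (suc r + n * 5)) ⟩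
  (X ^ˢ 5 ⊛ tail f ^ˢ 5) (5 + (suc r + n * 5))   ≈⟨ X^⊛-+ 5 (tail f ^ˢ 5) (suc r + n * 5) ⟩
  (tail f ^ˢ 5) (suc r + n * 5)                  ≈⟨ frobenius-5∤ (tail f) r n r<4 ⟩
  0                                              ∎
  where
  open ≈₅-Reasoning
  eq : suc r + suc n * 5 ≡ 5 + (suc r + n * 5)
  eq = ≡.trans (≡.sym (ℕ.+-assoc (suc r) 5 (n * 5)))
       (≡.trans (cong (_+ n * 5) (ℕ.+-comm (suc r) 5)) (ℕ.+-assoc 5 (suc r) (n * 5)))

split5 : ∀ m → ∃₂ λ r n → r < 5 × m ≡ r + n * 5
split5 m = m % 5 , m / 5 , m%n<n m 5 , m≡m%n+[m/n]*n m 5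

r+n*5≈r : ∀ r n → r + n * 5 ≈₅ r
r+n*5≈r r n = mod5 ([m+kn]%n≡m%n r n 5)

frobenius-zero : ∀ f i → ¬ i ≈₅ 0 → (f ^ˢ 5) i ≈₅ 0
frobenius-zero f i i≉0 with split5 i
... | zero  , n , _       , ≡.refl = contradiction (r+n*5≈r 0 n) i≉0
... | suc r , n , s≤s r<4 , ≡.refl = frobenius-5∤ f r n r<4

X^⊛frobenius-zero : ∀ f s i → ¬ i ≈₅ s → (X ^ˢ s ⊛ f ^ˢ 5) i ≈₅ 0
X^⊛frobenius-zero f zero i i≉0 = 𝔽.trans (at (𝕊.*-identityˡ (f ^ˢ 5)) i) (frobenius-zero f i i≉0)
X^⊛frobenius-zero f (suc s) zero    _   = X^⊛-suc s (f ^ˢ 5) 0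
X^⊛frobenius-zero f (suc s) (suc i) i≉s = 𝔽.trans (X^⊛-suc s (f ^ˢ 5) (suc i))
  (X^⊛frobenius-zero f s i λ i≈s → i≉s (+-cong₅ (𝔽.refl {1}) i≈s))

-- Dissection of a series by the residue of the exponent modulo 5.

section : ℕ → Series → Series
section r f n = f (r + n * 5)

section-cong : ∀ r {f g} → f ≋ g → section r f ≋ section r g
section-cong r p = pointwise λ n → at p (r + n * 5)

-- Reassembles a series from its sections: at k = 5 it is the inverse of the 5-dissection, with
-- `g r` at q^5 written as a fifth power. Smaller k serve the induction.
interleave : ℕ → (ℕ → Series) → Series
interleave zero    g = 𝕊.0#
interleave (suc k) g = interleave k g ⊕ X ^ˢ k ⊛ g k ^ˢ 5

interleave-zero : ∀ k g i → (∀ s → s < k → ¬ i ≈₅ s) → interleave k g i ≈₅ 0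
interleave-zero zero    g i _ = const0≈0 i
interleave-zero (suc k) g i ∉ = +-cong₅
  (interleave-zero k g i λ s s<k → ∉ s (ℕ.m<n⇒m<1+n s<k))
  (X^⊛frobenius-zero (g k) k i (∉ k ℕ.≤-refl))

≈₅⇒≡ : ∀ {r s} → r < 5 → s < 5 → r ≈₅ s → r ≡ s
≈₅⇒≡ r<5 s<5 (mod5 p) = ≡.trans (≡.sym (m<n⇒m%n≡m r<5)) (≡.trans p (m<n⇒m%n≡m s<5))

-- The summand with index s has only exponents congruent to s, and distinct indices below 5 are
-- distinct residues.
section-interleave : ∀ k g r → k ≤ 5 → r < k → section r (interleave k g) ≋ g r
section-interleave (suc k) g r k<5 r<1+k = pointwise coeff
  where
  open ≈₅-Reasoning
  off : ∀ {s} n → r ≡.≢ s → r < 5 → s < 5 → ¬ r + n * 5 ≈₅ s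
  off n r≢s r<5 s<5 p = r≢s (≈₅⇒≡ r<5 s<5 (𝔽.trans (𝔽.sym (r+n*5≈r r n)) p))
  r<5 : r < 5
  r<5 = ℕ.<-≤-trans r<1+k k<5
  coeff : ∀ n → section r (interleave (suc k) g) n ≈₅ g r n
  coeff n with ℕ.m≤n⇒m<n∨m≡n (s≤s⁻¹ r<1+k)
  ... | inj₁ r<k = begin
    interleave k g (r + n * 5) + (X ^ˢ k ⊛ g k ^ˢ 5) (r + n * 5)
      ≈⟨ +-cong₅ (at (section-interleave k g r (ℕ.<⇒≤ k<5) r<k) n)
                 (X^⊛frobenius-zero (g k) k (r + n * 5) (off n (ℕ.<⇒≢ r<k) r<5 k<5)) ⟩
    g r n + 0  ≈⟨ 𝔽.+-identityʳ (g r n) ⟩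
    g r n      ∎
  ... | inj₂ ≡.refl = +-cong₅
    (interleave-zero k g (r + n * 5) λ s s<r →
      off n (λ r≡s → ℕ.<⇒≢ s<r (≡.sym r≡s)) r<5 (ℕ.<-trans s<r k<5))
    (𝔽.trans (X^⊛-+ k (g k ^ˢ 5) (n * 5)) (frobenius-5∣ (g k) n))

sections-injective : ∀ {f g} → (∀ r → r < 5 → section r f ≋ section r g) → f ≋ g
sections-injective {f} {g} p = pointwise coeff
  where
  coeff : ∀ m → f m ≈₅ g m
  coeff m with split5 m
  ... | r , n , r<5 , ≡.refl = at (p r r<5) n

dissect : ∀ f → f ≋ interleave 5 (λ r → section r f)
dissect f = sections-injective λ r r<5 →
  𝕊.sym (section-interleave 5 (λ s → section s f) r ℕ.≤-refl r<5)

-- The fifth power is absorbed by each summand of the dissection of g: f^5 · q^r · h^5 = q^r · (f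
-- h)^5.
section-frobenius-⊛ : ∀ f g → section 0 (f ^ˢ 5 ⊛ g) ≋ f ⊛ section 0 g
section-frobenius-⊛ f g = begin
  section 0 (f ^ˢ 5 ⊛ g)
    ≈⟨ section-cong 0 (𝕊.*-congˡ {f ^ˢ 5} (dissect g)) ⟩
  section 0 (f ^ˢ 5 ⊛ interleave 5 (λ r → section r g))
    ≈⟨ section-cong 0 (distribute f X (section 0 g) (section 1 g) (section 2 g)
                                      (section 3 g) (section 4 g)) ⟩
  section 0 (interleave 5 (λ r → f ⊛ section r g))
    ≈⟨ section-interleave 5 (λ r → f ⊛ section r g) 0 ℕ.≤-refl (s≤s z≤n) ⟩
  f ⊛ section 0 g  ∎
  where
  open ≋-Reasoning
  open 𝕊-Solver
  -- The terms `con 0` and `x :^ 0` copy the unfolding of `interleave 5`, so that the solved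
  -- identity fits by computation.
  distribute = solve 7 (λ f x a b c d e →
    f :^ 5 :* (con 0 :+ x :^ 0 :* a :^ 5 :+ x :^ 1 :* b :^ 5 :+ x :^ 2 :* c :^ 5
                     :+ x :^ 3 :* d :^ 5 :+ x :^ 4 :* e :^ 5)
    := con 0 :+ x :^ 0 :* (f :* a) :^ 5 :+ x :^ 1 :* (f :* b) :^ 5 :+ x :^ 2 :* (f :* c) :^ 5
             :+ x :^ 3 :* (f :* d) :^ 5 :+ x :^ 4 :* (f :* e) :^ 5) 𝕊.refl

-- Gauss' identity

-- The constant -1, in the shape in which the solver interprets `con 4`.
ν : Series
ν = 4 ×ˢ 𝕊.1#

-- This is -q. In it the summands of θ are pure powers, as j and j^2 have the same parity: (-1)^j
-- q^(j^2) = (-q)^(j^2).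
Y : Series
Y = ν ⊛ X

∑< : ℕ → (ℕ → Series) → Series
∑< zero    f = 𝕊.0#
∑< (suc k) f = ∑< k f ⊕ f k

-- The q-Pochhammer symbol (q^k; q)_d.
falling : ℕ → ℕ → Series
falling k zero    = 𝕊.1#
falling k (suc d) = (𝕊.1# ⊕ ν ⊛ X ^ˢ k) ⊛ falling (suc k) d

-- The symbol (-1; q)_k. Its first factor 1 + q^0 = 2 accounts for the coefficient 2 of the squares
-- in θ.
rising : ℕ → Series
rising zero    = 𝕊.1#
rising (suc k) = rising k ⊛ (𝕊.1# ⊕ X ^ˢ k)

-- For σ = -1 and σ = 1 these are the truncated numerator and denominator of Gauss' product.
product : Series → ℕ → Series
product σ zero    = 𝕊.1#
product σ (suc n) = product σ n ⊛ (𝕊.1# ⊕ σ ⊛ X ^ˢ suc n)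

-- The partial sums of φ(-q), with q = X.
θ≤ : ℕ → Series
θ≤ zero    = 𝕊.1#
θ≤ (suc n) = θ≤ n ⊕ 2 ×ˢ (ν ^ˢ suc n ⊛ X ^ˢ (suc n * suc n))

falling-top : ∀ k d → falling k (suc d) ≋ falling k d ⊛ (𝕊.1# ⊕ ν ⊛ X ^ˢ (k + d))
falling-top k zero = 𝕊.trans (𝕊.*-comm _ _)
  (𝕊.*-congˡ (𝕊.+-congˡ (𝕊.*-congˡ (^-congʳ X (≡.sym (ℕ.+-identityʳ k))))))
falling-top k (suc d) = 𝕊.trans (𝕊.*-congˡ (falling-top (suc k) d))
  (𝕊.trans (𝕊.sym (𝕊.*-assoc _ _ _))
    (𝕊.*-congˡ (𝕊.+-congˡ (𝕊.*-congˡ (^-congʳ X (≡.sym (ℕ.+-suc k d)))))))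

falling-product : ∀ n → falling 1 n ≋ product ν n
falling-product zero    = 𝕊.refl
falling-product (suc n) = 𝕊.trans (falling-top 1 n) (𝕊.*-congʳ (falling-product n))

rising-product : ∀ n → rising (suc n) ≋ 2 ×ˢ (product 𝕊.1# n)
rising-product zero    = solve 0 (con 1 :* (con 1 :+ con 1) := con 1 :+ con 1) 𝕊.refl
  where open 𝕊-Solver
rising-product (suc n) = 𝕊.trans (𝕊.*-congʳ (rising-product n))
  (solve 2 (λ d x → (d :+ d) :* (con 1 :+ x) := d :* (con 1 :+ con 1 :* x) :+ d :* (con 1 :+ con 1 :* x)) 𝕊.refl
    (product 𝕊.1# n) (X ^ˢ suc n))
  where open 𝕊-Solver

-- Gauss' identity in the finite form ∏_{i≤n} (1 + X^i) · θ≤ n = ∑_{k≤n} term n k; the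
-- recurrence in n satisfied by the right-hand side telescopes through certificate.
term : ℕ → ℕ → Series
term n k = ν ^ˢ k ⊛ (X ^ˢ (k * suc n) ⊛ (rising k ⊛ falling (suc k) (n ℕ.∸ k)))

-- For k ≤ n, `certificate (suc n) k` is (1 - q^k) times `term n k`, as in Zeilberger's method. It
-- vanishes at k = 0, and at k = n + 1 it leaves the boundary term carrying the new square
-- q^((n+1)^2).
certificate : ℕ → ℕ → Series
certificate n k = ν ^ˢ k ⊛ (X ^ˢ (k * n) ⊛ (rising k ⊛ falling k (n ℕ.∸ k)))

-- Everything is a multiple of `term n k`; with y = q^k and z = q^(n+1) both sides have cofactor 1 -
-- y z.
certificate-step : ∀ n k → k ≤ n →
  certificate (suc n) k ⊕ term (suc n) k
  ≋ (𝕊.1# ⊕ X ^ˢ suc n) ⊛ term n k ⊕ certificate (suc n) (suc k)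
certificate-step n k k≤n = begin
  certificate (suc n) k ⊕ term (suc n) k
    ≈⟨ 𝕊.+-cong (𝕊.*-congˡ (𝕊.*-congˡ (𝕊.*-congˡ (𝕊.reflexive (cong (falling k) 1+n∸k)))))
                (𝕊.*-congˡ (𝕊.*-cong X^ (𝕊.*-congˡ
                  (𝕊.trans (𝕊.reflexive (cong (falling (suc k)) 1+n∸k)) top)))) ⟩
  e ⊛ (w ⊛ (r ⊛ ((𝕊.1# ⊕ ν ⊛ y) ⊛ P))) ⊕ e ⊛ ((y ⊛ w) ⊛ (r ⊛ (P ⊛ (𝕊.1# ⊕ ν ⊛ z))))
    ≈⟨ solve 6 (λ e w r y z P →
         e :* (w :* (r :* ((con 1 :+ con 4 :* y) :* P)))
           :+ e :* ((y :* w) :* (r :* (P :* (con 1 :+ con 4 :* z))))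
         := (con 1 :+ z) :* (e :* (w :* (r :* P)))
           :+ (con 4 :* e) :* ((z :* w) :* ((r :* (con 1 :+ y)) :* P))) 𝕊.refl e w r y z P ⟩
  (𝕊.1# ⊕ z) ⊛ term n k ⊕ (ν ⊛ e) ⊛ ((z ⊛ w) ⊛ ((r ⊛ (𝕊.1# ⊕ y)) ⊛ P))
    ≈⟨ 𝕊.+-congˡ (𝕊.*-congˡ (𝕊.*-congʳ (^-homo-* X (suc n) (k * suc n)))) ⟨
  (𝕊.1# ⊕ z) ⊛ term n k ⊕ certificate (suc n) (suc k)  ∎
  where
  open ≋-Reasoning
  open 𝕊-Solver
  e = ν ^ˢ k
  w = X ^ˢ (k * suc n)
  r = rising k
  y = X ^ˢ k
  z = X ^ˢ suc n
  P = falling (suc k) (n ℕ.∸ k)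
  1+n∸k : suc n ℕ.∸ k ≡ suc (n ℕ.∸ k)
  1+n∸k = ℕ.+-∸-assoc 1 k≤n
  X^ : X ^ˢ (k * suc (suc n)) ≋ y ⊛ w
  X^ = 𝕊.trans (^-congʳ X (ℕ.*-suc k (suc n))) (^-homo-* X k (k * suc n))
  top : falling (suc k) (suc (n ℕ.∸ k)) ≋ P ⊛ (𝕊.1# ⊕ ν ⊛ z)
  top = 𝕊.trans (falling-top (suc k) (n ℕ.∸ k))
    (𝕊.*-congˡ (𝕊.+-congˡ (𝕊.*-congˡ (^-congʳ X (cong suc (ℕ.m+[n∸m]≡n k≤n))))))

telescope : ∀ n k → k ≤ suc n →
  ∑< k (term (suc n)) ≋ (𝕊.1# ⊕ X ^ˢ suc n) ⊛ ∑< k (term n) ⊕ certificate (suc n) k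
-- The certificate is 0 here, since `falling 0 (suc n)` begins with the factor 1 - q^0.
telescope n zero _ = solve 2 (λ z P →
    con 0 := (con 1 :+ z) :* con 0 :+ con 1 :* (con 1 :* (con 1 :* ((con 1 :+ con 4 :* con 1) :* P))))
    𝕊.refl (X ^ˢ suc n) (falling 1 n)
  where open 𝕊-Solver
telescope n (suc k) (s≤s k≤n) = begin
  ∑< k (term (suc n)) ⊕ term (suc n) k
    ≈⟨ 𝕊.+-congʳ (telescope n k (ℕ.m≤n⇒m≤1+n k≤n)) ⟩
  (z ⊛ ∑< k (term n) ⊕ certificate (suc n) k) ⊕ term (suc n) k
    ≈⟨ 𝕊.+-assoc (z ⊛ ∑< k (term n)) (certificate (suc n) k) (term (suc n) k) ⟩
  z ⊛ ∑< k (term n) ⊕ (certificate (suc n) k ⊕ term (suc n) k)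
    ≈⟨ 𝕊.+-congˡ {z ⊛ ∑< k (term n)} (certificate-step n k k≤n) ⟩
  z ⊛ ∑< k (term n) ⊕ (z ⊛ term n k ⊕ certificate (suc n) (suc k))
    ≈⟨ solve 4 (λ z s t c → z :* s :+ (z :* t :+ c) := z :* (s :+ t) :+ c) 𝕊.refl
         z (∑< k (term n)) (term n k) (certificate (suc n) (suc k)) ⟩
  z ⊛ (∑< k (term n) ⊕ term n k) ⊕ certificate (suc n) (suc k)  ∎
  where
  open ≋-Reasoning
  open 𝕊-Solver
  z = 𝕊.1# ⊕ X ^ˢ suc n

-- In the induction step the new square is multiplied by (1 + q^(n+1)) times the old product. The
-- two resulting pieces are exactly the boundary term of `telescope` and the last summand
-- `term (suc n) (suc n)`.
product⊛θ≤ : ∀ n → product 𝕊.1# n ⊛ θ≤ n ≋ ∑< (suc n) (term n)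
product⊛θ≤ zero = solve 0
  (con 1 :* con 1 := con 0 :+ con 1 :* (con 1 :* (con 1 :* con 1))) 𝕊.refl
  where open 𝕊-Solver
product⊛θ≤ (suc n) = begin
  product 𝕊.1# (suc n) ⊛ (θ≤ n ⊕ 2 ×ˢ (e ⊛ w))
    ≈⟨ solve 5 (λ d z s e w → (d :* (con 1 :+ con 1 :* z)) :* (s :+ (e :* w :+ e :* w))
         := (con 1 :+ z) :* (d :* s) :+ (e :* (w :* (d :+ d)) :+ e :* ((z :* w) :* (d :+ d))))
         𝕊.refl (product 𝕊.1# n) (X ^ˢ suc n) (θ≤ n) e w ⟩
  z ⊛ (product 𝕊.1# n ⊛ θ≤ n) ⊕ (e ⊛ (w ⊛ 2 ×ˢ (product 𝕊.1# n)) ⊕ e ⊛ ((X ^ˢ suc n ⊛ w) ⊛ 2 ×ˢ (product 𝕊.1# n)))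
    ≈⟨ 𝕊.+-cong (𝕊.*-congˡ (product⊛θ≤ n)) (𝕊.+-cong (𝕊.*-congˡ (𝕊.*-congˡ (fall n (suc n))))
         (𝕊.*-congˡ (𝕊.*-cong (𝕊.sym X^) (fall (suc n) (suc (suc n)))))) ⟩
  z ⊛ ∑< (suc n) (term n) ⊕ (certificate (suc n) (suc n) ⊕ term (suc n) (suc n))
    ≈⟨ 𝕊.+-assoc (z ⊛ ∑< (suc n) (term n)) (certificate (suc n) (suc n)) (term (suc n) (suc n)) ⟨
  (z ⊛ ∑< (suc n) (term n) ⊕ certificate (suc n) (suc n)) ⊕ term (suc n) (suc n)
    ≈⟨ 𝕊.+-congʳ (telescope n (suc n) ℕ.≤-refl) ⟨
  ∑< (suc (suc n)) (term (suc n))  ∎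
  where
  open ≋-Reasoning
  open 𝕊-Solver
  z = 𝕊.1# ⊕ X ^ˢ suc n
  e = ν ^ˢ suc n
  w = X ^ˢ (suc n * suc n)
  X^ : X ^ˢ (suc n * suc (suc n)) ≋ X ^ˢ suc n ⊛ w
  X^ = 𝕊.trans (^-congʳ X (ℕ.*-suc (suc n) (suc n))) (^-homo-* X (suc n) (suc n * suc n))
  fall : ∀ m k → 2 ×ˢ (product 𝕊.1# n) ≋ rising (suc n) ⊛ falling k (m ℕ.∸ m)
  fall m k = 𝕊.sym (𝕊.trans (𝕊.*-congˡ (𝕊.reflexive (cong (falling k) (ℕ.n∸n≡0 m))))
    (𝕊.trans (𝕊.*-identityʳ _) (rising-product n)))

-- Agreement up to degree n, and Gauss' identity for the full theta series.

infix 4 _≋[_]_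
_≋[_]_ : Series → ℕ → Series → Set
f ≋[ n ] g = ∀ i → i ≤ n → f i ≈₅ g i

≋⇒≋[] : ∀ {f g n} → f ≋ g → f ≋[ n ] g
≋⇒≋[] p i _ = at p i

trans[] : ∀ {f g h n} → f ≋[ n ] g → g ≋[ n ] h → f ≋[ n ] h
trans[] p q i i≤n = 𝔽.trans (p i i≤n) (q i i≤n)

sym[] : ∀ {f g n} → f ≋[ n ] g → g ≋[ n ] f
sym[] p i i≤n = 𝔽.sym (p i i≤n)

⊛-cong[] : ∀ {f f′ g g′ n} → f ≋[ n ] f′ → g ≋[ n ] g′ → f ⊛ g ≋[ n ] f′ ⊛ g′
⊛-cong[] p q i i≤n = ⊛-cong-≤ i (λ j j≤i → p j (ℕ.≤-trans j≤i i≤n))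
                                (λ j j≤i → q j (ℕ.≤-trans j≤i i≤n))

-- The power of q in front has exponent at least n + 1. Hence up to degree n only the summand (q;
-- q)_n at index 0 survives, and the finite identity becomes Gauss' identity.
term-zero : ∀ n k i → i ≤ n → term n (suc k) i ≈₅ 0
term-zero n k i i≤n = begin
  term n (suc k) i
    ≈⟨ at (solve 3 (λ e w u → e :* (w :* u) := w :* (e :* u)) 𝕊.refl
             (ν ^ˢ suc k) (X ^ˢ (suc k * suc n)) u) i ⟩
  (X ^ˢ (suc k * suc n) ⊛ (ν ^ˢ suc k ⊛ u)) i
    ≈⟨ X^⊛-zero (suc k * suc n) (ν ^ˢ suc k ⊛ u) (ℕ.≤-trans (s≤s i≤n) (ℕ.m≤m+n (suc n) (k * suc n))) ⟩
  0  ∎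
  where
  open ≈₅-Reasoning
  open 𝕊-Solver
  u = rising (suc k) ⊛ falling (suc (suc k)) (n ℕ.∸ suc k)

∑term≋falling : ∀ n k → ∑< (suc k) (term n) ≋[ n ] falling 1 n
∑term≋falling n zero i i≤n = at (solve 1 (λ f →
  con 0 :+ con 1 :* (con 1 :* (con 1 :* f)) := f) 𝕊.refl (falling 1 n)) i
  where open 𝕊-Solver
∑term≋falling n (suc k) i i≤n = 𝔽.trans (+-cong₅ (∑term≋falling n k i i≤n) (term-zero n k i i≤n))
  (𝔽.+-identityʳ _)

gauss : ∀ n → product 𝕊.1# n ⊛ θ≤ n ≋[ n ] product ν n
gauss n = trans[] (≋⇒≋[] (product⊛θ≤ n)) (trans[] (∑term≋falling n n) (≋⇒≋[] (falling-product n)))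

-- The diagonal of the partial sums: the squares added after `θ≤ n` start at (n+1)^2 and leave the
-- coefficient of q^n unchanged.
θ : Series
θ n = θ≤ n n

θ≤-suc : ∀ n → θ≤ (suc n) ≋[ n ] θ≤ n
θ≤-suc n i i≤n = 𝔽.trans (𝔽.+-congˡ {θ≤ n i} vanish) (𝔽.+-identityʳ (θ≤ n i))
  where
  open 𝕊-Solver
  vanish : (2 ×ˢ (ν ^ˢ suc n ⊛ X ^ˢ (suc n * suc n))) i ≈₅ 0
  vanish = 𝔽.trans (at (solve 2 (λ e x → e :* x :+ e :* x := x :* (e :+ e)) 𝕊.refl
                          (ν ^ˢ suc n) (X ^ˢ (suc n * suc n))) i)
    (X^⊛-zero (suc n * suc n) (2 ×ˢ ν ^ˢ suc n) (ℕ.≤-trans (s≤s i≤n) (ℕ.m≤m+n (suc n) (n * suc n))))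

θ≋θ≤ : ∀ n → θ ≋[ n ] θ≤ n
θ≋θ≤ zero    zero    z≤n = 𝔽.refl
θ≋θ≤ (suc n) i i≤1+n with ℕ.m≤n⇒m<n∨m≡n i≤1+n
... | inj₁ (s≤s i≤n) = 𝔽.trans (θ≋θ≤ n i i≤n) (𝔽.sym (θ≤-suc n i i≤n))
... | inj₂ ≡.refl    = 𝔽.refl

product⊛θ : ∀ n → product 𝕊.1# n ⊛ θ ≋[ n ] product ν n
product⊛θ n = trans[] (⊛-cong[] (λ _ _ → 𝔽.refl) (θ≋θ≤ n)) (gauss n)

-- The substitute for division by u: in degree n + 1 the product is `f (suc n)` plus an expression
-- in lower coefficients of f, which agree by induction.
⊛-cancelˡ[] : ∀ u {f g} n → u 0 ≡ 1 → u ⊛ f ≋[ n ] u ⊛ g → f ≋[ n ] g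
⊛-cancelˡ[] u {f} {g} zero u₀≡1 p zero z≤n = begin
  f 0        ≈⟨ 𝔽.*-identityˡ (f 0) ⟨
  1 * f 0    ≡⟨ cong (_* f 0) u₀≡1 ⟨
  u 0 * f 0  ≈⟨ p 0 z≤n ⟩
  u 0 * g 0  ≡⟨ cong (_* g 0) u₀≡1 ⟩
  1 * g 0    ≈⟨ 𝔽.*-identityˡ (g 0) ⟩
  g 0        ∎
  where open ≈₅-Reasoning
⊛-cancelˡ[] u {f} {g} (suc n) u₀≡1 p i i≤1+n with ℕ.m≤n⇒m<n∨m≡n i≤1+n
... | inj₁ (s≤s i≤n) = ⊛-cancelˡ[] u n u₀≡1 (λ j j≤n → p j (ℕ.m≤n⇒m≤1+n j≤n)) i i≤n
... | inj₂ ≡.refl = +-cancelˡ-≈₅ ((tail u ⊛ f) n) (begin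
  (tail u ⊛ f) n + f (suc n)        ≡⟨ ℕ.+-comm _ (f (suc n)) ⟩
  f (suc n) + (tail u ⊛ f) n        ≡⟨ cong (_+ (tail u ⊛ f) n) (ℕ.*-identityˡ (f (suc n))) ⟨
  1 * f (suc n) + (tail u ⊛ f) n    ≡⟨ cong (λ a → a * f (suc n) + (tail u ⊛ f) n) u₀≡1 ⟨
  u 0 * f (suc n) + (tail u ⊛ f) n  ≈⟨ p (suc n) ℕ.≤-refl ⟩
  u 0 * g (suc n) + (tail u ⊛ g) n  ≡⟨ cong (λ a → a * g (suc n) + (tail u ⊛ g) n) u₀≡1 ⟩
  1 * g (suc n) + (tail u ⊛ g) n    ≡⟨ cong (_+ (tail u ⊛ g) n) (ℕ.*-identityˡ (g (suc n))) ⟩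
  g (suc n) + (tail u ⊛ g) n        ≡⟨ ℕ.+-comm (g (suc n)) _ ⟩
  (tail u ⊛ g) n + g (suc n)        ≈⟨ +-cong₅ (⊛-cong[] {tail u} (λ _ _ → 𝔽.refl) f≋g n ℕ.≤-refl)
                                              (𝔽.refl {g (suc n)}) ⟨
  (tail u ⊛ f) n + g (suc n)        ∎)
  where
  open ≈₅-Reasoning
  f≋g : f ≋[ n ] g
  f≋g = ⊛-cancelˡ[] u n u₀≡1 (λ j j≤n → p j (ℕ.m≤n⇒m≤1+n j≤n))

^-cong[] : ∀ {f g n} k → f ≋[ n ] g → f ^ˢ k ≋[ n ] g ^ˢ k
^-cong[] zero    p i i≤n = 𝔽.refl
^-cong[] (suc k) p = ⊛-cong[] p (^-cong[] k p)

-- Generating functions of overpartitions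

∑ : ℕ → (ℕ → ℕ) → ℕ
∑ zero    u = 0
∑ (suc n) u = u 0 + ∑ n (λ i → u (suc i))

∑-cong : ∀ n {u v} → (∀ i → u i ≡ v i) → ∑ n u ≡ ∑ n v
∑-cong zero    p = ≡.refl
∑-cong (suc n) p = cong₂ _+_ (p 0) (∑-cong n (λ i → p (suc i)))

∑-zero : ∀ n {u} → (∀ i → u i ≡ 0) → ∑ n u ≡ 0
∑-zero zero    p = ≡.refl
∑-zero (suc n) p = cong₂ _+_ (p 0) (∑-zero n (λ i → p (suc i)))

∑-truncate : ∀ n k {u} → (∀ i → n ≤ i → u i ≡ 0) → ∑ (n + k) u ≡ ∑ n u
∑-truncate zero    k p = ∑-zero k (λ i → p i z≤n)
∑-truncate (suc n) k {u} p = cong (u 0 +_) (∑-truncate n k (λ i n≤i → p (suc i) (s≤s n≤i)))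

length-concat-applyUpTo : ∀ {A : Set} (f : ℕ → List A) h n →
  length (concat (map f (applyUpTo h n))) ≡ ∑ n (λ i → length (f (h i)))
length-concat-applyUpTo f h zero    = ≡.refl
length-concat-applyUpTo f h (suc n) = ≡.trans (length-++ (f (h 0)))
  (cong (length (f (h 0)) +_) (length-concat-applyUpTo f (λ i → h (suc i)) n))

G : ℕ → ℕ → Series
G ℓ k n = length (overparts ℓ n k)

-- The contribution of multiplicity m of the part p, doubled by the choice of overlining.
-- Multiplicity 0 is doubled as well, which makes the shift in `multiples-suc` uniform.
multiples : Series → ℕ → ℕ → ℕ → ℕ
multiples g p n m with m * p ≤? n
... | yes _ = g (n ∸ m * p) + g (n ∸ m * p)
... | no  _ = 0

multiples-zero : ∀ g p n m → n < m * p → multiples g p n m ≡ 0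
multiples-zero g p n m n<mp with m * p ≤? n
... | yes mp≤n = contradiction mp≤n (ℕ.<⇒≱ n<mp)
... | no  _    = ≡.refl

multiples-suc : ∀ g p n m → multiples g p (p + n) (suc m) ≡ multiples g p n m
multiples-suc g p n m with suc m * p ≤? p + n | m * p ≤? n
... | yes _ | yes _ = cong₂ _+_ eq eq
  where eq = cong g (ℕ.[m+n]∸[m+o]≡n∸o p n (m * p))
... | no  _ | no  _ = ≡.refl
... | yes q | no  r = contradiction (ℕ.+-cancelˡ-≤ p _ _ q) r
... | no  q | yes r = contradiction (ℕ.+-monoʳ-≤ p r) q

module _ {ℓ k : ℕ} (ℓ∤ : ¬ ℓ ∣ suc k) where

  -- The local functions of overparts are not in scope; the list of choices is
  -- recovered by unification.
  choices : ∀ n → Σ (ℕ → List Overpartition) λ f →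
    overparts ℓ n (suc k) ≡ overparts ℓ n k ++ concat (map f (applyUpTo suc n))
  choices zero with ℓ ∣? suc k
  ... | yes p = contradiction p ℓ∤
  ... | no _  = (λ _ → []) , ≡.refl
  choices (suc n) with ℓ ∣? suc k
  ... | yes p = contradiction p ℓ∤
  ... | no _  = _ , ≡.refl

  length-choices : ∀ n m →
    length (proj₁ (choices n) (suc m)) ≡ multiples (G ℓ k) (suc k) n (suc m)
  length-choices zero m with ℓ ∣? suc k
  ... | yes p = contradiction p ℓ∤
  ... | no _  = ≡.refl
  length-choices (suc n) m with ℓ ∣? suc k
  ... | yes p = contradiction p ℓ∤
  ... | no _ with suc m * suc k ≤? suc n
  ...   | no _  = ≡.refl
  ...   | yes _ = ≡.trans
    (length-++ (map (block (suc k) (suc m) true ++_) rest))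
    (cong₂ _+_ (length-map _ rest) (length-map _ rest))
    where rest = overparts ℓ (suc n ∸ suc m * suc k) k

  G-suc : ∀ n → G ℓ (suc k) n ≡ G ℓ k n + ∑ n (λ m → multiples (G ℓ k) (suc k) n (suc m))
  G-suc n = ≡.trans (cong length (proj₂ (choices n))) (≡.trans (length-++ (overparts ℓ n k))
    (cong (G ℓ k n +_) (≡.trans (length-concat-applyUpTo (proj₁ (choices n)) suc n)
      (∑-cong n (length-choices n)))))

  G-suc-< : ∀ n → n < suc k → G ℓ (suc k) n ≡ G ℓ k n
  G-suc-< n n<1+k = ≡.trans (G-suc n) (≡.trans
    (cong (G ℓ k n +_) (∑-zero n λ m → multiples-zero (G ℓ k) (suc k) n (suc m)
      (ℕ.<-≤-trans n<1+k (ℕ.m≤m+n (suc k) (m * suc k)))))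
    (ℕ.+-identityʳ _))

  -- Removing one copy of the part k + 1 turns multiplicities m ≥ 1 into m ≥ 0. The new case m = 0
  -- counts twice; one of the two completes the remaining sum to `G ℓ (suc k) n`.
  G-suc-+ : ∀ n → G ℓ (suc k) (suc k + n) ≡ G ℓ k (suc k + n) + (G ℓ (suc k) n + G ℓ k n)
  G-suc-+ n = ≡.trans (G-suc (suc k + n)) (cong (g (suc k + n) +_) (begin
    ∑ (suc k + n) (λ m → multiples g (suc k) (suc k + n) (suc m))
      ≡⟨ ∑-cong (suc k + n) (multiples-suc g (suc k) n) ⟩
    (g n + g n) + ∑ (k + n) (λ m → multiples g (suc k) n (suc m))
      ≡⟨ cong (λ j → (g n + g n) + ∑ j (λ m → multiples g (suc k) n (suc m))) (ℕ.+-comm k n) ⟩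
    (g n + g n) + ∑ (n + k) (λ m → multiples g (suc k) n (suc m))
      ≡⟨ cong ((g n + g n) +_) (∑-truncate n k λ m n≤m → multiples-zero g (suc k) n (suc m)
           (ℕ.≤-trans (s≤s n≤m) (ℕ.m≤m*n (suc m) (suc k)))) ⟩
    (g n + g n) + ∑ n (λ m → multiples g (suc k) n (suc m))
      ≡⟨ ℕ.+-assoc (g n) (g n) _ ⟩
    g n + (g n + ∑ n (λ m → multiples g (suc k) n (suc m)))
      ≡⟨ cong (g n +_) (G-suc n) ⟨
    g n + G ℓ (suc k) n
      ≡⟨ ℕ.+-comm (g n) _ ⟩
    G ℓ (suc k) n + g n  ∎))
    where
    open ≡.≡-Reasoning
    g = G ℓ k

  -- The subtraction-free form of multiplying by (1 + q^(k+1)) / (1 - q^(k+1)), the factor of the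
  -- part k + 1.
  G-suc-∤ : G ℓ (suc k) ≋ G ℓ k ⊕ X ^ˢ suc k ⊛ (G ℓ (suc k) ⊕ G ℓ k)
  G-suc-∤ = pointwise coeff
    where
    rec = G ℓ (suc k) ⊕ G ℓ k
    coeff : ∀ n → G ℓ (suc k) n ≈₅ G ℓ k n + (X ^ˢ suc k ⊛ rec) n
    coeff n with ℕ.<-≤-connex n (suc k)
    ... | inj₁ n<1+k = 𝔽.trans (≡⇒≈₅ (≡.trans (G-suc-< n n<1+k) (≡.sym (ℕ.+-identityʳ (G ℓ k n)))))
      (𝔽.+-congˡ {G ℓ k n} (𝔽.sym (X^⊛-zero (suc k) rec n<1+k)))
    ... | inj₂ 1+k≤n with ℕ.m≤n⇒∃[o]m+o≡n 1+k≤n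
    ...   | j , ≡.refl = 𝔽.trans (≡⇒≈₅ (G-suc-+ j))
      (𝔽.+-congˡ {G ℓ k (suc k + j)} (𝔽.sym (X^⊛-+ (suc k) rec j)))

-- The case split on n is there because `overparts ℓ n (suc k)` does not unfold while n is a
-- variable.
G-suc-∣ : ∀ {ℓ k} → ℓ ∣ suc k → ∀ n → G ℓ (suc k) n ≡ G ℓ k n
G-suc-∣ {ℓ} {k} ℓ∣ zero with ℓ ∣? suc k
... | yes _ = ≡.refl
... | no ℓ∤ = contradiction ℓ∣ ℓ∤
G-suc-∣ {ℓ} {k} ℓ∣ (suc n) with ℓ ∣? suc k
... | yes _ = ≡.refl
... | no ℓ∤ = contradiction ℓ∣ ℓ∤

-- Parts larger than n cannot occur. The counts `Abar ℓ n`, each with its own bound n, thus become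
-- coefficients of one series `G ℓ k` up to degree k.
G-stable : ∀ ℓ n j → G ℓ (j + n) n ≡ G ℓ n n
G-stable ℓ n zero    = ≡.refl
G-stable ℓ n (suc j) with ℓ ∣? suc (j + n)
... | yes ℓ∣ = ≡.trans (G-suc-∣ ℓ∣ n) (G-stable ℓ n j)
... | no  ℓ∤ = ≡.trans (G-suc-< ℓ∤ n (s≤s (ℕ.m≤n+m n j))) (G-stable ℓ n j)

G-zero : ∀ ℓ → G ℓ 0 ≋ 𝕊.1#
G-zero ℓ = pointwise λ { zero → 𝔽.refl ; (suc n) → 𝔽.refl }

restrictedProduct : ℕ → Series → ℕ → Series
restrictedProduct ℓ σ zero = 𝕊.1#
restrictedProduct ℓ σ (suc k) with ℓ ∣? suc k
... | yes _ = restrictedProduct ℓ σ k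
... | no  _ = restrictedProduct ℓ σ k ⊛ (𝕊.1# ⊕ σ ⊛ X ^ˢ suc k)

G⊛restrictedProduct : ∀ ℓ k → G ℓ k ⊛ restrictedProduct ℓ ν k ≋ restrictedProduct ℓ 𝕊.1# k
G⊛restrictedProduct ℓ zero = 𝕊.trans (𝕊.*-congʳ (G-zero ℓ)) (𝕊.*-identityˡ 𝕊.1#)
G⊛restrictedProduct ℓ (suc k) with ℓ ∣? suc k | G-suc-∤ {ℓ} {k} | G-suc-∣ {ℓ} {k}
... | yes ℓ∣ | _ | eq = 𝕊.trans (𝕊.*-congʳ (pointwise λ n → ≡⇒≈₅ (eq ℓ∣ n))) (G⊛restrictedProduct ℓ k)
... | no  ℓ∤ | rec | _ = begin
  g′ ⊛ (c ⊛ (𝕊.1# ⊕ ν ⊛ x))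
    ≈⟨ solve 3 (λ g c x → g :* (c :* (con 1 :+ con 4 :* x)) := c :* (g :+ con 4 :* x :* g)) 𝕊.refl g′ c x ⟩
  c ⊛ (g′ ⊕ ν ⊛ x ⊛ g′)
    ≈⟨ 𝕊.*-congˡ (𝕊.+-congʳ (rec ℓ∤)) ⟩
  c ⊛ ((g ⊕ x ⊛ (g′ ⊕ g)) ⊕ ν ⊛ x ⊛ g′)
    ≈⟨ solve 4 (λ g g′ c x → c :* ((g :+ x :* (g′ :+ g)) :+ con 4 :* x :* g′)
         := (g :* c) :* (con 1 :+ con 1 :* x)) 𝕊.refl g g′ c x ⟩
  (g ⊛ c) ⊛ (𝕊.1# ⊕ 𝕊.1# ⊛ x)
    ≈⟨ 𝕊.*-congʳ (G⊛restrictedProduct ℓ k) ⟩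
  restrictedProduct ℓ 𝕊.1# k ⊛ (𝕊.1# ⊕ 𝕊.1# ⊛ x)  ∎
  where
  open ≋-Reasoning
  open 𝕊-Solver
  g = G ℓ k
  g′ = G ℓ (suc k)
  c = restrictedProduct ℓ ν k
  x = X ^ˢ suc k

-- The property of ℓ = 5^α on which the product computation rests. The condition σ^5 = σ holds for σ
-- = 1 and σ = -1, the two signs in Gauss' product.
Frobenius : ℕ → Set
Frobenius ℓ = ∀ σ → σ ^ˢ 5 ≋ σ → ∀ x → (𝕊.1# ⊕ σ ⊛ x) ^ˢ ℓ ≋ 𝕊.1# ⊕ σ ⊛ x ^ˢ ℓ

frobenius-5^ : ∀ α → Frobenius (5 ℕ.^ α)
frobenius-5^ zero σ σ⁵ x = solve 2 (λ s x → (con 1 :+ s :* x) :^ 1 := con 1 :+ s :* x :^ 1) 𝕊.refl σ x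
  where open 𝕊-Solver
frobenius-5^ (suc α) σ σ⁵ x = begin
  (𝕊.1# ⊕ σ ⊛ x) ^ˢ (5 * 5 ℕ.^ α)         ≈⟨ ^-assocʳ (𝕊.1# ⊕ σ ⊛ x) 5 (5 ℕ.^ α) ⟨
  ((𝕊.1# ⊕ σ ⊛ x) ^ˢ 5) ^ˢ (5 ℕ.^ α)
    ≈⟨ ^-congˡ (5 ℕ.^ α) (solve 2 (λ s x → (con 1 :+ s :* x) :^ 5 := con 1 :+ s :^ 5 :* x :^ 5) 𝕊.refl σ x) ⟩
  (𝕊.1# ⊕ σ ^ˢ 5 ⊛ x ^ˢ 5) ^ˢ (5 ℕ.^ α)   ≈⟨ ^-congˡ (5 ℕ.^ α) (𝕊.+-congˡ (𝕊.*-congʳ σ⁵)) ⟩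
  (𝕊.1# ⊕ σ ⊛ x ^ˢ 5) ^ˢ (5 ℕ.^ α)        ≈⟨ frobenius-5^ α σ σ⁵ (x ^ˢ 5) ⟩
  𝕊.1# ⊕ σ ⊛ (x ^ˢ 5) ^ˢ (5 ℕ.^ α)        ≈⟨ 𝕊.+-congˡ (𝕊.*-congˡ (^-assocʳ x 5 (5 ℕ.^ α))) ⟩
  𝕊.1# ⊕ σ ⊛ x ^ˢ (5 * 5 ℕ.^ α)           ∎
  where
  open ≋-Reasoning
  open 𝕊-Solver

restrictedProduct-∣ : ∀ {ℓ} σ k → ℓ ∣ suc k → restrictedProduct ℓ σ (suc k) ≋ restrictedProduct ℓ σ k
restrictedProduct-∣ {ℓ} σ k ℓ∣ with ℓ ∣? suc k
... | yes _ = 𝕊.refl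
... | no ℓ∤ = contradiction ℓ∣ ℓ∤

restrictedProduct-∤ : ∀ {ℓ} σ k → ¬ ℓ ∣ suc k →
  restrictedProduct ℓ σ (suc k) ≋ restrictedProduct ℓ σ k ⊛ (𝕊.1# ⊕ σ ⊛ X ^ˢ suc k)
restrictedProduct-∤ {ℓ} σ k ℓ∤ with ℓ ∣? suc k
... | yes ℓ∣ = contradiction ℓ∣ ℓ∤
... | no _   = 𝕊.refl

module _ (l : ℕ) (frobenius : Frobenius (suc l)) where
  private
    ℓ = suc l
    open ≋-Reasoning
    open 𝕊-Solver

  -- The factors left out on the restricted side are 1 + σ q^(i ℓ) for i ≤ m, each the ℓ-th power of
  -- 1 + σ q^i by `frobenius`. Writing the bound as j + m ℓ with j < ℓ shows at every step whether ℓ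
  -- divides the next index.
  restrictedProduct⊛product^ : ∀ σ → σ ^ˢ 5 ≋ σ → ∀ m j → j < ℓ →
    restrictedProduct ℓ σ (j + m * ℓ) ⊛ product σ m ^ˢ ℓ ≋ product σ (j + m * ℓ)
  restrictedProduct⊛product^ σ σ⁵ zero zero _ = 𝕊.trans (𝕊.*-identityˡ _) (1^ ℓ)
  restrictedProduct⊛product^ σ σ⁵ m (suc j) 1+j<ℓ = begin
    restrictedProduct ℓ σ (suc j + m * ℓ) ⊛ p
      ≈⟨ 𝕊.*-congʳ (restrictedProduct-∤ σ (j + m * ℓ) ℓ∤) ⟩
    (c ⊛ x) ⊛ p
      ≈⟨ solve 3 (λ c x p → (c :* x) :* p := (c :* p) :* x) 𝕊.refl c x p ⟩
    (c ⊛ p) ⊛ x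
      ≈⟨ 𝕊.*-congʳ (restrictedProduct⊛product^ σ σ⁵ m j (ℕ.<-trans ℕ.≤-refl 1+j<ℓ)) ⟩
    product σ (suc j + m * ℓ)  ∎
    where
    c = restrictedProduct ℓ σ (j + m * ℓ)
    p = product σ m ^ˢ ℓ
    x = 𝕊.1# ⊕ σ ⊛ X ^ˢ (suc j + m * ℓ)
    ℓ∤ : ¬ ℓ ∣ suc j + m * ℓ
    ℓ∤ d = >⇒∤ 1+j<ℓ (∣m+n∣m⇒∣n (≡.subst (ℓ ∣_) (ℕ.+-comm (suc j) (m * ℓ)) d) (n∣m*n m))
  restrictedProduct⊛product^ σ σ⁵ (suc m) zero _ = begin
    restrictedProduct ℓ σ (suc m * ℓ) ⊛ (product σ m ⊛ (𝕊.1# ⊕ σ ⊛ X ^ˢ suc m)) ^ˢ ℓ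
      ≈⟨ 𝕊.*-cong (restrictedProduct-∣ σ (l + m * ℓ) (n∣m*n (suc m)))
                  (^-distrib-* (product σ m) (𝕊.1# ⊕ σ ⊛ X ^ˢ suc m) ℓ) ⟩
    c ⊛ (product σ m ^ˢ ℓ ⊛ (𝕊.1# ⊕ σ ⊛ X ^ˢ suc m) ^ˢ ℓ)
      ≈⟨ 𝕊.*-assoc c _ _ ⟨
    (c ⊛ product σ m ^ˢ ℓ) ⊛ (𝕊.1# ⊕ σ ⊛ X ^ˢ suc m) ^ˢ ℓ
      ≈⟨ 𝕊.*-cong (restrictedProduct⊛product^ σ σ⁵ m l ℕ.≤-refl)
           (𝕊.trans (frobenius σ σ⁵ (X ^ˢ suc m)) (𝕊.+-congˡ (𝕊.*-congˡ (^-assocʳ X (suc m) ℓ)))) ⟩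
    product σ (suc m * ℓ)  ∎
    where
    c = restrictedProduct ℓ σ (l + m * ℓ)

product-head : ∀ n → product 𝕊.1# n 0 ≡ 1
product-head zero    = ≡.refl
product-head (suc n) = ≡.trans (ℕ.*-identityʳ _) (product-head n)

^-head : ∀ f k → f 0 ≡ 1 → (f ^ˢ k) 0 ≡ 1
^-head f zero    p = ≡.refl
^-head f (suc k) p = cong₂ _*_ p (^-head f k p)

1⁵ : 𝕊.1# ^ˢ 5 ≋ 𝕊.1#
1⁵ = 1^ 5

ν⁵ : ν ^ˢ 5 ≋ ν
ν⁵ = solve 0 (con 4 :^ 5 := con 4) 𝕊.refl
  where open 𝕊-Solver

overpartitions : ℕ → Series
overpartitions ℓ n = Abar ℓ n

-- After multiplication by `p ⊛ q`, which has constant term 1, both sides equal `p ⊛ r` up to degree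
-- m. Gauss' identity is used at length k on the left and, under the ℓ-th power, at length m on the
-- right.
overpartitions⊛θ : ∀ ℓ .{{_ : NonZero ℓ}} → Frobenius ℓ → overpartitions ℓ ⊛ θ ≋ θ ^ˢ ℓ
overpartitions⊛θ ℓ@(suc l) frobenius = pointwise λ n → truncated n n ℕ.≤-refl
  where
  truncated : ∀ m → overpartitions ℓ ⊛ θ ≋[ m ] θ ^ˢ ℓ
  truncated m = ⊛-cancelˡ[] (p ⊛ q) m
    (cong₂ _*_ (product-head k) (^-head (product 𝕊.1# m) ℓ (product-head m)))
    (trans[] (⊛-cong[] {p ⊛ q} (λ _ _ → 𝔽.refl) (⊛-cong[] {g = θ} F≋G (λ _ _ → 𝔽.refl)))
    (trans[] (≋⇒≋[] (solve 4 (λ p q g t → (p :* q) :* (g :* t) := (g :* q) :* (p :* t)) 𝕊.refl p q g θ))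
    (trans[] (⊛-cong[] {g ⊛ q} (λ _ _ → 𝔽.refl) (λ i i≤m → product⊛θ k i (ℕ.≤-trans i≤m m≤k)))
    (trans[] (≋⇒≋[] exact)
    (trans[] (⊛-cong[] {p} (λ _ _ → 𝔽.refl) (sym[] (^-cong[] ℓ (product⊛θ m))))
    (≋⇒≋[] (𝕊.trans (𝕊.*-congˡ {p} (^-distrib-* (product 𝕊.1# m) θ ℓ)) (𝕊.sym (𝕊.*-assoc p q (θ ^ˢ ℓ))))))))))
    where
    open 𝕊-Solver
    open ≋-Reasoning
    -- A multiple of ℓ, so that all m complementary factors are complete, and at least m, so that
    -- Gauss' identity is precise enough.
    k = m * ℓ
    m≤k : m ≤ k
    m≤k = ℕ.m≤m*n m ℓ
    g = G ℓ k
    p = product 𝕊.1# k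
    q = product 𝕊.1# m ^ˢ ℓ
    r = product ν m ^ˢ ℓ
    F≋G : overpartitions ℓ ≋[ m ] g
    F≋G i i≤m = ≡⇒≈₅ (≡.sym (≡.trans
      (cong (λ j → G ℓ j i) (≡.sym (ℕ.m∸n+n≡m (ℕ.≤-trans i≤m m≤k)))) (G-stable ℓ i (k ∸ i))))
    exact : (g ⊛ q) ⊛ product ν k ≋ p ⊛ r
    exact = begin
      (g ⊛ q) ⊛ product ν k
        ≈⟨ 𝕊.*-congˡ {g ⊛ q} (restrictedProduct⊛product^ l frobenius ν ν⁵ m 0 (s≤s z≤n)) ⟨
      (g ⊛ q) ⊛ (restrictedProduct ℓ ν k ⊛ r)
        ≈⟨ solve 4 (λ g q c r → (g :* q) :* (c :* r) := ((g :* c) :* q) :* r) 𝕊.refl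
             g q (restrictedProduct ℓ ν k) r ⟩
      ((g ⊛ restrictedProduct ℓ ν k) ⊛ q) ⊛ r
        ≈⟨ 𝕊.*-congʳ (𝕊.*-congʳ (G⊛restrictedProduct ℓ k)) ⟩
      (restrictedProduct ℓ 𝕊.1# k ⊛ q) ⊛ r
        ≈⟨ 𝕊.*-congʳ (restrictedProduct⊛product^ l frobenius 𝕊.1# 1⁵ m 0 (s≤s z≤n)) ⟩
      p ⊛ r  ∎

-- Sums of one and two squares

open import Data.Integer using (+_)

module _ {A : Set} {P : A → Set} (P? : Decidable P) where

  count : List A → ℕ
  count xs = length (filter P? xs)

count-≐ : ∀ {A : Set} {P Q : A → Set} (P? : Decidable P) (Q? : Decidable Q) →
  (∀ {x} → P x → Q x) → (∀ {x} → Q x → P x) → ∀ xs → count P? xs ≡ count Q? xs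
count-≐ P? Q? P⊆Q Q⊆P xs = cong length (filter-≐ P? Q? (P⊆Q , Q⊆P) xs)

count-none : ∀ {A : Set} {P : A → Set} (P? : Decidable P) →
  (∀ x → ¬ P x) → ∀ xs → count P? xs ≡ 0
count-none P? ∄ xs = cong length (filter-none P? (All.universal ∄ xs))

count-∪-∩ : ∀ {A : Set} {P Q : A → Set} (P? : Decidable P) (Q? : Decidable Q) xs →
  count P? xs + count Q? xs ≡ count (P? ∪? Q?) xs + count (P? ∩? Q?) xs
count-∪-∩ P? Q? [] = ≡.refl
count-∪-∩ P? Q? (x ∷ xs) with P? x | Q? x
... | yes _ | yes _ = cong suc (≡.trans (ℕ.+-suc _ _) (≡.trans (cong suc (count-∪-∩ P? Q? xs)) (≡.sym (ℕ.+-suc _ _))))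
... | yes _ | no  _ = cong suc (count-∪-∩ P? Q? xs)
... | no  _ | yes _ = ≡.trans (ℕ.+-suc _ _) (cong suc (count-∪-∩ P? Q? xs))
... | no  _ | no  _ = count-∪-∩ P? Q? xs

-- The ambient lists need only be free of duplicates and contain all solutions, so that counts over
-- boxes of different sizes can be compared.
count-bijection : ∀ {A B : Set} {P : A → Set} {Q : B → Set} (P? : Decidable P) (Q? : Decidable Q)
  (f : A → B) → (∀ {x y} → f x ≡ f y → x ≡ y) →
  (∀ {x} → P x → Q (f x)) → (∀ {y} → Q y → ∃ λ x → P x × y ≡ f x) →
  ∀ {xs ys} → Unique xs → Unique ys → (∀ {x} → P x → x ∈ xs) → (∀ {y} → Q y → y ∈ ys) →
  count P? xs ≡ count Q? ys
count-bijection {P = P} {Q} P? Q? f inj P⇒Q surj {xs} {ys} xs! ys! P⊆xs Q⊆ys = ≡.trans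
  (≡.sym (length-map f (filter P? xs)))
  (↭-length (∼bag⇒↭ (unique∧set⇒bag (Unique.map⁺ inj (Unique.filter⁺ P? xs!)) (Unique.filter⁺ Q? ys!)
    (mk⇔ to from))))
  where
  to : ∀ {y} → y ∈ map f (filter P? xs) → y ∈ filter Q? ys
  to y∈ with ∈-map⁻ f y∈
  ... | x , x∈ , ≡.refl = ∈-filter⁺ Q? (Q⊆ys q) q
    where q = P⇒Q (proj₂ (∈-filter⁻ P? {xs = xs} x∈))
  from : ∀ {y} → y ∈ filter Q? ys → y ∈ map f (filter P? xs)
  from y∈ with surj (proj₂ (∈-filter⁻ Q? {xs = ys} y∈))
  ... | x , p , ≡.refl = ∈-map⁺ f (∈-filter⁺ P? (P⊆xs p) p)

-- Coefficients of θ and its square as signed counts of representations.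

ν≋const4 : ν ≋ const 4
ν≋const4 = pointwise λ { zero → 𝔽.refl ; (suc n) → 𝔽.refl }

Y⊛ : ∀ f n → (Y ⊛ f) n ≈₅ 4 * shift f n
Y⊛ f n = begin
  ((ν ⊛ X) ⊛ f) n        ≈⟨ at (𝕊.*-assoc ν X f) n ⟩
  (ν ⊛ (X ⊛ f)) n        ≈⟨ at (𝕊.*-congʳ {X ⊛ f} ν≋const4) n ⟩
  (const 4 ⊛ (X ⊛ f)) n  ≈⟨ const-⊛ 4 (X ⊛ f) n ⟩
  4 * (X ⊛ f) n          ≈⟨ *-cong₅ (𝔽.refl {4}) (X⊛ f n) ⟩
  4 * shift f n          ∎
  where open ≈₅-Reasoning

Y^-diagonal : ∀ n → (Y ^ˢ n) n ≈₅ 4 ^₅ n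
Y^-diagonal zero    = 𝔽.refl
Y^-diagonal (suc n) = 𝔽.trans (Y⊛ (Y ^ˢ n) (suc n)) (*-cong₅ (𝔽.refl {4}) (Y^-diagonal n))

Y^-off-diagonal : ∀ m n → ¬ m ≡ n → (Y ^ˢ m) n ≈₅ 0
Y^-off-diagonal zero    zero    m≢n = contradiction ≡.refl m≢n
Y^-off-diagonal zero    (suc n) m≢n = 𝔽.refl
Y^-off-diagonal (suc m) zero    m≢n = Y⊛ (Y ^ˢ m) 0
Y^-off-diagonal (suc m) (suc n) m≢n = 𝔽.trans (Y⊛ (Y ^ˢ m) (suc n))
  (*-cong₅ (𝔽.refl {4}) (Y^-off-diagonal m n (m≢n ∘ cong suc)))

-- The generating series of a finite family in powers of -q: its coefficients are counts with the
-- sign (-1)^n, and products correspond to cartesian products.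
monomials : {A : Set} → (A → ℕ) → List A → Series
monomials e []       = 𝕊.0#
monomials e (x ∷ xs) = Y ^ˢ e x ⊕ monomials e xs

monomials-count : ∀ {A : Set} (e : A → ℕ) xs n →
  monomials e xs n ≈₅ 4 ^₅ n * count (λ x → e x ℕ.≟ n) xs
monomials-count e [] n = 𝔽.trans (const0≈0 n) (𝔽.sym (𝔽.zeroʳ (4 ^₅ n)))
monomials-count e (x ∷ xs) n with e x ℕ.≟ n
... | yes ≡.refl = 𝔽.trans (+-cong₅ (Y^-diagonal n) (monomials-count e xs n))
  (≡⇒≈₅ (≡.sym (≡.trans (cong (λ ys → 4 ^₅ n * length ys) (filter-accept (λ y → e y ℕ.≟ n) ≡.refl))
    (ℕ.*-suc (4 ^₅ n) _))))
... | no e≢n     = 𝔽.trans (+-cong₅ (Y^-off-diagonal (e x) n e≢n) (monomials-count e xs n))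
  (≡⇒≈₅ (≡.sym (cong (λ ys → 4 ^₅ n * length ys) (filter-reject (λ y → e y ℕ.≟ n) e≢n))))

monomials-++ : ∀ {A : Set} (e : A → ℕ) xs ys →
  monomials e (xs ++ ys) ≋ monomials e xs ⊕ monomials e ys
monomials-++ e []       ys = 𝕊.sym (𝕊.+-identityˡ (monomials e ys))
monomials-++ e (x ∷ xs) ys = 𝕊.trans (𝕊.+-congˡ {Y ^ˢ e x} (monomials-++ e xs ys))
  (𝕊.sym (𝕊.+-assoc (Y ^ˢ e x) (monomials e xs) (monomials e ys)))

module _ {A B : Set} (d : A → ℕ) (e : B → ℕ) where

  sumExponent : A × B → ℕ
  sumExponent (x , y) = d x + e y

  monomials-row : ∀ x ys → monomials sumExponent (map (x ,_) ys) ≋ Y ^ˢ d x ⊛ monomials e ys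
  monomials-row x []       = 𝕊.sym (𝕊.zeroʳ (Y ^ˢ d x))
  monomials-row x (y ∷ ys) = 𝕊.trans (𝕊.+-cong (^-homo-* Y (d x) (e y)) (monomials-row x ys))
    (𝕊.sym (𝕊.distribˡ (Y ^ˢ d x) (Y ^ˢ e y) (monomials e ys)))

  monomials-⊛ : ∀ xs ys →
    monomials d xs ⊛ monomials e ys ≋ monomials sumExponent (cartesianProduct xs ys)
  monomials-⊛ []       ys = 𝕊.zeroˡ (monomials e ys)
  monomials-⊛ (x ∷ xs) ys = begin
    (Y ^ˢ d x ⊕ monomials d xs) ⊛ monomials e ys
      ≈⟨ 𝕊.distribʳ (monomials e ys) (Y ^ˢ d x) (monomials d xs) ⟩
    Y ^ˢ d x ⊛ monomials e ys ⊕ monomials d xs ⊛ monomials e ys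
      ≈⟨ 𝕊.+-cong (𝕊.sym (monomials-row x ys)) (monomials-⊛ xs ys) ⟩
    monomials sumExponent (map (x ,_) ys) ⊕ monomials sumExponent (cartesianProduct xs ys)
      ≈⟨ monomials-++ sumExponent (map (x ,_) ys) (cartesianProduct xs ys) ⟨
    monomials sumExponent (cartesianProduct (x ∷ xs) ys)  ∎
    where open ≋-Reasoning

box : ℕ → List ℤ
box zero    = + 0 ∷ []
box (suc n) = + suc n ∷ -[1+ n ] ∷ box n

∈-box : ∀ n {j} → ∣ j ∣ ≤ n → j ∈ box n
∈-box zero {+ zero} _ = here ≡.refl
∈-box (suc n) {j} ∣j∣≤1+n with ℕ.m≤n⇒m<n∨m≡n ∣j∣≤1+n
∈-box (suc n) {j} _      | inj₁ (s≤s ∣j∣≤n) = there (there (∈-box n ∣j∣≤n))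
∈-box (suc n) {+ _} _      | inj₂ ≡.refl = here ≡.refl
∈-box (suc n) { -[1+ _ ]} _ | inj₂ ≡.refl = there (here ≡.refl)

box-≤ : ∀ n {j} → j ∈ box n → ∣ j ∣ ≤ n
box-≤ zero    (here ≡.refl)         = z≤n
box-≤ (suc n) (here ≡.refl)         = ℕ.≤-refl
box-≤ (suc n) (there (here ≡.refl)) = ℕ.≤-refl
box-≤ (suc n) (there (there j∈))    = ℕ.m≤n⇒m≤1+n (box-≤ n j∈)

box-unique : ∀ n → Unique (box n)
box-unique zero    = All.[] ∷ []
box-unique (suc n) = ((λ ()) All.∷ fresh ≡.refl) ∷ fresh ≡.refl ∷ box-unique n
  where
  fresh : ∀ {j} → ∣ j ∣ ≡ suc n → All.All (λ i → ¬ j ≡ i) (box n)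
  fresh ∣j∣ = All.tabulate λ { i∈ ≡.refl → ℕ.<-irrefl ≡.refl (≡.subst (_≤ n) ∣j∣ (box-≤ n i∈)) }

square : ℤ → ℕ
square j = ∣ j ∣ * ∣ j ∣

∣j∣≤square : ∀ j → ∣ j ∣ ≤ square j
∣j∣≤square j with ∣ j ∣
... | zero  = z≤n
... | suc n = ℕ.m≤m*n (suc n) (suc n)

ν²≋1 : ν ⊛ ν ≋ 𝕊.1#
ν²≋1 = solve 0 (con 4 :* con 4 := con 1) 𝕊.refl
  where open 𝕊-Solver

ν^²≋ν^ : ∀ n → ν ^ˢ (n * n) ≋ ν ^ˢ n
ν^²≋ν^ zero    = 𝕊.refl
ν^²≋ν^ (suc n) = begin
  ν ^ˢ (suc n + n * suc n)               ≈⟨ ^-homo-* ν (suc n) (n * suc n) ⟩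
  ν ^ˢ suc n ⊛ ν ^ˢ (n * suc n)          ≈⟨ 𝕊.*-congˡ (^-congʳ ν (ℕ.*-suc n n)) ⟩
  ν ^ˢ suc n ⊛ ν ^ˢ (n + n * n)          ≈⟨ 𝕊.*-congˡ (^-homo-* ν n (n * n)) ⟩
  ν ^ˢ suc n ⊛ (ν ^ˢ n ⊛ ν ^ˢ (n * n))   ≈⟨ 𝕊.*-congˡ (𝕊.*-congˡ (ν^²≋ν^ n)) ⟩
  ν ^ˢ suc n ⊛ (ν ^ˢ n ⊛ ν ^ˢ n)         ≈⟨ 𝕊.*-congˡ (^-distrib-* ν ν n) ⟨
  ν ^ˢ suc n ⊛ (ν ⊛ ν) ^ˢ n              ≈⟨ 𝕊.*-congˡ (^-congˡ n ν²≋1) ⟩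
  ν ^ˢ suc n ⊛ 𝕊.1# ^ˢ n                 ≈⟨ 𝕊.*-congˡ (1^ n) ⟩
  ν ^ˢ suc n ⊛ 𝕊.1#                      ≈⟨ 𝕊.*-identityʳ _ ⟩
  ν ^ˢ suc n                             ∎
  where
  open ≋-Reasoning

θ≤≋monomials : ∀ n → θ≤ n ≋ monomials square (box n)
θ≤≋monomials zero    = 𝕊.sym (𝕊.+-identityʳ 𝕊.1#)
θ≤≋monomials (suc n) = begin
  θ≤ n ⊕ 2 ×ˢ (ν ^ˢ suc n ⊛ X ^ˢ (suc n * suc n))
    ≈⟨ 𝕊.+-cong (θ≤≋monomials n) (𝕊.+-cong Y^ Y^) ⟩
  monomials square (box n) ⊕ (Y ^ˢ (suc n * suc n) ⊕ Y ^ˢ (suc n * suc n))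
    ≈⟨ solve 2 (λ y m → m :+ (y :+ y) := y :+ (y :+ m)) 𝕊.refl (Y ^ˢ (suc n * suc n)) (monomials square (box n)) ⟩
  monomials square (box (suc n))  ∎
  where
  open ≋-Reasoning
  open 𝕊-Solver
  Y^ : ν ^ˢ suc n ⊛ X ^ˢ (suc n * suc n) ≋ Y ^ˢ (suc n * suc n)
  Y^ = 𝕊.trans (𝕊.*-congʳ (𝕊.sym (ν^²≋ν^ (suc n)))) (𝕊.sym (^-distrib-* ν X (suc n * suc n)))

norm : ℤ × ℤ → ℕ
norm = sumExponent square square

squares : ℕ → List (ℤ × ℤ)
squares n = cartesianProduct (box n) (box n)

θ-count : ∀ n → θ n ≈₅ 4 ^₅ n * count (λ j → square j ℕ.≟ n) (box n)
θ-count n = 𝔽.trans (at (θ≤≋monomials n) n) (monomials-count square (box n) n)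

θ²-count : ∀ n → (θ ⊛ θ) n ≈₅ 4 ^₅ n * count (λ z → norm z ℕ.≟ n) (squares n)
θ²-count n = begin
  (θ ⊛ θ) n                                     ≈⟨ ⊛-cong[] (θ≋θ≤ n) (θ≋θ≤ n) n ℕ.≤-refl ⟩
  (θ≤ n ⊛ θ≤ n) n                               ≈⟨ at (𝕊.*-cong (θ≤≋monomials n) (θ≤≋monomials n)) n ⟩
  (monomials square (box n) ⊛ monomials square (box n)) n
                                                ≈⟨ at (monomials-⊛ square square (box n) (box n)) n ⟩
  monomials norm (squares n) n                  ≈⟨ monomials-count norm (squares n) n ⟩
  4 ^₅ n * count (λ z → norm z ℕ.≟ n) (squares n)  ∎
  where open ≈₅-Reasoning

square-∈ : ∀ {n j} → square j ≡ n → j ∈ box n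
square-∈ {n} {j} ≡.refl = ∈-box n (∣j∣≤square j)

norm-∈ : ∀ {n z} → norm z ≡ n → z ∈ squares n
norm-∈ {n} {a , b} ≡.refl = ∈-cartesianProduct⁺
  (∈-box n (ℕ.≤-trans (∣j∣≤square a) (ℕ.m≤m+n (square a) (square b))))
  (∈-box n (ℕ.≤-trans (∣j∣≤square b) (ℕ.m≤n+m (square b) (square a))))

squares-unique : ∀ n → Unique (squares n)
squares-unique n = Unique.cartesianProduct⁺ (box-unique n) (box-unique n)

-- The sign (-1)^n is the same at n and 5n, so U acts on the counts themselves.
4^n*5 : ∀ n → 4 ^₅ (n * 5) ≈₅ 4 ^₅ n
4^n*5 n = 𝔽.trans (𝔽.sym (^₅-assocʳ 4 n 5)) (fermat (4 ^₅ n))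

prime5 : Prime 5
prime5 = from-yes (prime? 5)

square-scale : ∀ j → square (+ 5 ℤ.* j) ≡ square j * 5 * 5
square-scale j = begin
  ∣ + 5 ℤ.* j ∣ * ∣ + 5 ℤ.* j ∣  ≡⟨ cong₂ _*_ (ℤ.abs-* (+ 5) j) (ℤ.abs-* (+ 5) j) ⟩
  (5 * ∣ j ∣) * (5 * ∣ j ∣)      ≡⟨ ℕ.[m*n]*[o*p]≡[m*o]*[n*p] 5 (∣ j ∣) 5 (∣ j ∣) ⟩
  25 * square j                 ≡⟨ ℕ.*-comm 25 (square j) ⟩
  square j * 25                 ≡⟨ ℕ.*-assoc (square j) 5 5 ⟨
  square j * 5 * 5              ∎
  where open ≡.≡-Reasoning

scale-injective : ∀ {i j} → + 5 ℤ.* i ≡ + 5 ℤ.* j → i ≡ j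
scale-injective {i} {j} = ℤ.*-cancelˡ-≡ (+ 5) i j

5∣square : ∀ j {n} → square j ≡ n * 5 → ∃ λ i → j ≡ + 5 ℤ.* i × square i * 5 ≡ n
5∣square j {n} eq with ∣ᵤ⇒∣ {+ 5} {j} 5∣j
  where
  5∣j : 5 ∣ (∣ j ∣)
  5∣j with euclidsLemma (∣ j ∣) (∣ j ∣) prime5 (ℕ-divides n eq)
  ... | inj₁ d = d
  ... | inj₂ d = d
... | divides i ≡.refl rewrite ℤ.*-comm i (+ 5) = i , ≡.refl ,
  ℕ.*-cancelʳ-≡ (square i * 5) n 5 (≡.trans (≡.sym (square-scale i)) eq)

r+n*5≢m*5 : ∀ {r} n m → r < 4 → ¬ m * 5 ≡ suc r + n * 5
r+n*5≢m*5 {r} n m r<4 eq = contradiction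
  (≈₅⇒≡ (s≤s z≤n) (s≤s r<4)
    (𝔽.trans (𝔽.sym (r+n*5≈r 0 m)) (𝔽.trans (≡⇒≈₅ eq) (r+n*5≈r (suc r) n))))
  λ ()

-- A square divisible by 5 has the form 25 i^2, so U θ is the sum of (-1)^i q^(5 i^2), which is θ at
-- q^5.
section₀-θ : section 0 θ ≋ θ ^ˢ 5
section₀-θ = pointwise coeff
  where
  coeff : ∀ n → θ (n * 5) ≈₅ (θ ^ˢ 5) n
  coeff n with split5 n
  ... | zero , m , _ , ≡.refl = begin
    θ (m * 5 * 5)
      ≈⟨ θ-count (m * 5 * 5) ⟩
    4 ^₅ (m * 5 * 5) * count (λ j → square j ℕ.≟ m * 5 * 5) (box (m * 5 * 5))
      ≈⟨ *-cong₅ (𝔽.trans (4^n*5 (m * 5)) (4^n*5 m)) (≡⇒≈₅ (≡.sym same)) ⟩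
    4 ^₅ m * count (λ j → square j ℕ.≟ m) (box m)
      ≈⟨ θ-count m ⟨
    θ m
      ≈⟨ frobenius-5∣ θ m ⟨
    (θ ^ˢ 5) (m * 5)  ∎
    where
    open ≈₅-Reasoning
    surj : ∀ {j} → square j ≡ m * 5 * 5 → ∃ λ i → square i ≡ m × j ≡ + 5 ℤ.* i
    surj {j} eq with 5∣square j eq
    ... | i , j≡ , eq′ = i , ℕ.*-cancelʳ-≡ (square i) m 5 eq′ , j≡
    same : count (λ j → square j ℕ.≟ m) (box m) ≡ count (λ j → square j ℕ.≟ m * 5 * 5) (box (m * 5 * 5))
    same = count-bijection (λ j → square j ℕ.≟ m) (λ j → square j ℕ.≟ m * 5 * 5) (+ 5 ℤ.*_) scale-injective
      (λ {j} → λ { ≡.refl → square-scale j }) surj (box-unique m) (box-unique (m * 5 * 5))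
      square-∈ square-∈
  ... | suc r , m , s≤s r<4 , ≡.refl = begin
    θ (k * 5)
      ≈⟨ θ-count (k * 5) ⟩
    4 ^₅ (k * 5) * count (λ j → square j ℕ.≟ k * 5) (box (k * 5))
      ≈⟨ *-cong₅ (𝔽.refl {4 ^₅ (k * 5)}) (≡⇒≈₅ (count-none (λ j → square j ℕ.≟ k * 5) none (box (k * 5)))) ⟩
    4 ^₅ (k * 5) * 0
      ≈⟨ 𝔽.zeroʳ (4 ^₅ (k * 5)) ⟩
    0
      ≈⟨ frobenius-5∤ θ r m r<4 ⟨
    (θ ^ˢ 5) k  ∎
    where
    open ≈₅-Reasoning
    k = suc r + m * 5
    none : ∀ j → ¬ square j ≡ k * 5
    none j eq with 5∣square j eq
    ... | i , _ , eq′ = r+n*5≢m*5 m (square i) r<4 eq′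

section-θ-nonresidue : ∀ r → (∀ i → i < 5 → ¬ i * i ≈₅ r) → section r θ ≋ 𝕊.0#
section-θ-nonresidue r nonresidue = pointwise λ n → begin
  θ (r + n * 5)
    ≈⟨ θ-count (r + n * 5) ⟩
  4 ^₅ (r + n * 5) * count (λ j → square j ℕ.≟ r + n * 5) (box (r + n * 5))
    ≈⟨ *-cong₅ (𝔽.refl {4 ^₅ (r + n * 5)})
         (≡⇒≈₅ (count-none (λ j → square j ℕ.≟ r + n * 5) (none n) (box (r + n * 5)))) ⟩
  4 ^₅ (r + n * 5) * 0
    ≈⟨ 𝔽.zeroʳ (4 ^₅ (r + n * 5)) ⟩
  0
    ≈⟨ const0≈0 n ⟨
  𝕊.0# n  ∎
  where
  open ≈₅-Reasoning
  none : ∀ n j → ¬ square j ≡ r + n * 5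
  none n j eq = nonresidue (∣ j ∣ % 5) (m%n<n (∣ j ∣) 5)
    (𝔽.trans (mod5 (≡.sym (%-distribˡ-* (∣ j ∣) (∣ j ∣) 5))) (𝔽.trans (≡⇒≈₅ eq) (r+n*5≈r r n)))

+square : ∀ j → + square j ≡ j ℤ.* j
+square (+ n)    = ℤ.pos-* n n
+square -[1+ n ] = ≡.refl

+norm : ∀ a b → + norm (a , b) ≡ a ℤ.* a ℤ.+ b ℤ.* b
+norm a b = ≡.trans (ℤ.pos-+ (square a) (square b)) (cong₂ ℤ._+_ (+square a) (+square b))

norm-scale : ∀ a b → norm (+ 5 ℤ.* a , + 5 ℤ.* b) ≡ norm (a , b) * 5 * 5
norm-scale a b = ≡.trans (cong₂ _+_ (square-scale a) (square-scale b)) (≡.sym (≡.trans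
  (cong (_* 5) (ℕ.*-distribʳ-+ 5 (square a) (square b)))
  (ℕ.*-distribʳ-+ 5 (square a * 5) (square b * 5))))

-- Multiplication by the Gaussian integer 2 + i or 2 - i, up to units.
module Rotation (ε : ℤ) (ε² : ε ℤ.* ε ≡ + 1) where
  open ≡.≡-Reasoning

  rotate : ℤ × ℤ → ℤ × ℤ
  rotate (m , n) = m ℤ.+ + 2 ℤ.* n , ε ℤ.* (+ 2 ℤ.* m ℤ.- n)

  ε-involutive : ∀ x → ε ℤ.* (ε ℤ.* x) ≡ x
  ε-involutive x = ≡.trans (≡.sym (ℤ.*-assoc ε ε x)) (≡.trans (cong (ℤ._* x) ε²) (ℤ.*-identityˡ x))

  norm-rotate : ∀ z → norm (rotate z) ≡ norm z * 5
  norm-rotate z@(m , n) = ℤ.+-injective (begin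
    + norm (rotate z)
      ≡⟨ +norm (proj₁ (rotate z)) (proj₂ (rotate z)) ⟩
    (m ℤ.+ + 2 ℤ.* n) ℤ.* (m ℤ.+ + 2 ℤ.* n) ℤ.+ (ε ℤ.* (+ 2 ℤ.* m ℤ.- n)) ℤ.* (ε ℤ.* (+ 2 ℤ.* m ℤ.- n))
      ≡⟨ collect m n ε ⟩
    (m ℤ.+ + 2 ℤ.* n) ℤ.* (m ℤ.+ + 2 ℤ.* n) ℤ.+ (ε ℤ.* ε) ℤ.* ((+ 2 ℤ.* m ℤ.- n) ℤ.* (+ 2 ℤ.* m ℤ.- n))
      ≡⟨ cong (λ e → (m ℤ.+ + 2 ℤ.* n) ℤ.* (m ℤ.+ + 2 ℤ.* n) ℤ.+ e ℤ.* ((+ 2 ℤ.* m ℤ.- n) ℤ.* (+ 2 ℤ.* m ℤ.- n))) ε² ⟩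
    (m ℤ.+ + 2 ℤ.* n) ℤ.* (m ℤ.+ + 2 ℤ.* n) ℤ.+ + 1 ℤ.* ((+ 2 ℤ.* m ℤ.- n) ℤ.* (+ 2 ℤ.* m ℤ.- n))
      ≡⟨ expand m n ⟩
    (m ℤ.* m ℤ.+ n ℤ.* n) ℤ.* + 5
      ≡⟨ cong (ℤ._* + 5) (+norm m n) ⟨
    + norm z ℤ.* + 5
      ≡⟨ ℤ.pos-* (norm z) 5 ⟨
    + (norm z * 5)  ∎)
    where
    collect : ∀ m n e →
      (m ℤ.+ + 2 ℤ.* n) ℤ.* (m ℤ.+ + 2 ℤ.* n) ℤ.+ (e ℤ.* (+ 2 ℤ.* m ℤ.- n)) ℤ.* (e ℤ.* (+ 2 ℤ.* m ℤ.- n))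
      ≡ (m ℤ.+ + 2 ℤ.* n) ℤ.* (m ℤ.+ + 2 ℤ.* n) ℤ.+ (e ℤ.* e) ℤ.* ((+ 2 ℤ.* m ℤ.- n) ℤ.* (+ 2 ℤ.* m ℤ.- n))
    collect = solve-∀
    expand : ∀ m n →
      (m ℤ.+ + 2 ℤ.* n) ℤ.* (m ℤ.+ + 2 ℤ.* n) ℤ.+ + 1 ℤ.* ((+ 2 ℤ.* m ℤ.- n) ℤ.* (+ 2 ℤ.* m ℤ.- n))
      ≡ (m ℤ.* m ℤ.+ n ℤ.* n) ℤ.* + 5
    expand = solve-∀

  unrotate : ℤ × ℤ → ℤ × ℤ
  unrotate (a , b) = a ℤ.+ + 2 ℤ.* (ε ℤ.* b) , + 2 ℤ.* a ℤ.- ε ℤ.* b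

  unrotate-rotate : ∀ m n → unrotate (rotate (m , n)) ≡ (+ 5 ℤ.* m , + 5 ℤ.* n)
  unrotate-rotate m n = ≡.trans
    (cong (λ b → (m ℤ.+ + 2 ℤ.* n) ℤ.+ + 2 ℤ.* b , + 2 ℤ.* (m ℤ.+ + 2 ℤ.* n) ℤ.- b)
      (ε-involutive (+ 2 ℤ.* m ℤ.- n)))
    (cong₂ _,_ (fst m n) (snd m n))
    where
    fst : ∀ m n → (m ℤ.+ + 2 ℤ.* n) ℤ.+ + 2 ℤ.* (+ 2 ℤ.* m ℤ.- n) ≡ + 5 ℤ.* m
    fst = solve-∀
    snd : ∀ m n → + 2 ℤ.* (m ℤ.+ + 2 ℤ.* n) ℤ.- (+ 2 ℤ.* m ℤ.- n) ≡ + 5 ℤ.* n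
    snd = solve-∀

  rotate-injective : ∀ {z w} → rotate z ≡ rotate w → z ≡ w
  rotate-injective {m , n} {m′ , n′} eq = cong₂ _,_
    (scale-injective (cong proj₁ eq′)) (scale-injective (cong proj₂ eq′))
    where
    eq′ : (+ 5 ℤ.* m , + 5 ℤ.* n) ≡ (+ 5 ℤ.* m′ , + 5 ℤ.* n′)
    eq′ = ≡.trans (≡.sym (unrotate-rotate m n)) (≡.trans (cong unrotate eq) (unrotate-rotate m′ n′))

  -- The multiples of a Gaussian prime of norm 5 form a sublattice of index 5, cut out by one
  -- congruence.
  Image : ℤ × ℤ → Set
  Image (a , b) = + 5 ∣ℤ ε ℤ.* b ℤ.- + 2 ℤ.* a

  image? : Decidable Image
  image? (a , b) = + 5 ∣ℤ? (ε ℤ.* b ℤ.- + 2 ℤ.* a)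

  rotate-image : ∀ z → Image (rotate z)
  rotate-image (m , n) = divides (ℤ.- n)
    (≡.trans (cong (ℤ._- (+ 2 ℤ.* (m ℤ.+ + 2 ℤ.* n))) (ε-involutive (+ 2 ℤ.* m ℤ.- n))) (eq m n))
    where
    eq : ∀ m n → (+ 2 ℤ.* m ℤ.- n) ℤ.- + 2 ℤ.* (m ℤ.+ + 2 ℤ.* n) ≡ ℤ.- n ℤ.* + 5
    eq = solve-∀

  image-rotate : ∀ z → Image z → ∃ λ w → z ≡ rotate w
  -- For a = m + 2n and ε b = 2m - n the difference ε b - 2a is -5n; hence n = -q and m = a - 2n.
  image-rotate (a , b) (divides q eq) = (a ℤ.+ + 2 ℤ.* q , ℤ.- q) , cong₂ _,_ (fst a q) (≡.sym (begin
    ε ℤ.* (+ 2 ℤ.* (a ℤ.+ + 2 ℤ.* q) ℤ.- ℤ.- q)     ≡⟨ cong (ε ℤ.*_) (snd a q) ⟩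
    ε ℤ.* (q ℤ.* + 5 ℤ.+ + 2 ℤ.* a)                  ≡⟨ cong (λ s → ε ℤ.* (s ℤ.+ + 2 ℤ.* a)) eq ⟨
    ε ℤ.* ((ε ℤ.* b ℤ.- + 2 ℤ.* a) ℤ.+ + 2 ℤ.* a)    ≡⟨ cong (ε ℤ.*_) (cancel (ε ℤ.* b) a) ⟩
    ε ℤ.* (ε ℤ.* b)                                  ≡⟨ ε-involutive b ⟩
    b                                                ∎))
    where
    fst : ∀ a q → a ≡ (a ℤ.+ + 2 ℤ.* q) ℤ.+ + 2 ℤ.* (ℤ.- q)
    fst = solve-∀
    snd : ∀ a q → + 2 ℤ.* (a ℤ.+ + 2 ℤ.* q) ℤ.- ℤ.- q ≡ q ℤ.* + 5 ℤ.+ + 2 ℤ.* a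
    snd = solve-∀
    cancel : ∀ x a → (x ℤ.- + 2 ℤ.* a) ℤ.+ + 2 ℤ.* a ≡ x
    cancel = solve-∀

  count-image : ∀ n → count (λ z → norm z ℕ.≟ n) (squares n)
    ≡ count ((λ z → norm z ℕ.≟ n * 5) ∩? image?) (squares (n * 5))
  count-image n = count-bijection (λ z → norm z ℕ.≟ n) ((λ z → norm z ℕ.≟ n * 5) ∩? image?)
    rotate rotate-injective
    (λ {z} eq → ≡.trans (norm-rotate z) (cong (_* 5) eq) , rotate-image z)
    surj (squares-unique n) (squares-unique (n * 5)) norm-∈ (norm-∈ ∘ proj₁)
    where
    surj : ∀ {z} → norm z ≡ n * 5 × Image z → ∃ λ w → norm w ≡ n × z ≡ rotate w
    surj {z} (eq , im) with image-rotate z im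
    ... | w , ≡.refl = w , ℕ.*-cancelʳ-≡ (norm w) n 5 (≡.trans (≡.sym (norm-rotate w)) eq) , ≡.refl

module R₊ = Rotation (+ 1) ≡.refl
module R₋ = Rotation -[1+ 0 ] ≡.refl

-- The identity (b - 2a)(-b - 2a) = 5 a^2 - (a^2 + b^2) shows that 5 divides the product, hence one
-- of the factors.
image₊∪image₋ : ∀ z n → norm z ≡ n * 5 → R₊.Image z ⊎ R₋.Image z
image₊∪image₋ z@(a , b) n eq with euclidsLemma (∣ x ∣) (∣ y ∣) prime5
    (≡.subst (5 ∣_) (ℤ.abs-* x y) (∣⇒∣ᵤ {+ 5} {x ℤ.* y} (divides (a ℤ.* a ℤ.- + n) product-eq)))
  where
  x = + 1 ℤ.* b ℤ.- + 2 ℤ.* a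
  y = -[1+ 0 ] ℤ.* b ℤ.- + 2 ℤ.* a
  factor : ∀ a b → (+ 1 ℤ.* b ℤ.- + 2 ℤ.* a) ℤ.* (-[1+ 0 ] ℤ.* b ℤ.- + 2 ℤ.* a)
    ≡ a ℤ.* a ℤ.* + 5 ℤ.- (a ℤ.* a ℤ.+ b ℤ.* b)
  factor = solve-∀
  regroup : ∀ s n → s ℤ.* + 5 ℤ.- n ℤ.* + 5 ≡ (s ℤ.- n) ℤ.* + 5
  regroup = solve-∀
  open ≡.≡-Reasoning
  product-eq : x ℤ.* y ≡ (a ℤ.* a ℤ.- + n) ℤ.* + 5
  product-eq = begin
    x ℤ.* y                                          ≡⟨ factor a b ⟩
    a ℤ.* a ℤ.* + 5 ℤ.- (a ℤ.* a ℤ.+ b ℤ.* b)        ≡⟨ cong (λ k → a ℤ.* a ℤ.* + 5 ℤ.- k) (+norm a b) ⟨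
    a ℤ.* a ℤ.* + 5 ℤ.- + norm z                     ≡⟨ cong (λ k → a ℤ.* a ℤ.* + 5 ℤ.- + k) eq ⟩
    a ℤ.* a ℤ.* + 5 ℤ.- + (n * 5)                    ≡⟨ cong (λ k → a ℤ.* a ℤ.* + 5 ℤ.- k) (ℤ.pos-* n 5) ⟩
    a ℤ.* a ℤ.* + 5 ℤ.- + n ℤ.* + 5                  ≡⟨ regroup (a ℤ.* a) (+ n) ⟩
    (a ℤ.* a ℤ.- + n) ℤ.* + 5                        ∎
... | inj₁ d = inj₁ (∣ᵤ⇒∣ d)
... | inj₂ d = inj₂ (∣ᵤ⇒∣ d)

scale : ℤ × ℤ → ℤ × ℤ
scale (a , b) = + 5 ℤ.* a , + 5 ℤ.* b

-- With x = b - 2a and y = -b - 2a one has x + y = -4a and x - y = 2b. Thus a = 5a + (x + y) and b =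
-- 5b - 2 (x - y), from which the quotients by 5 are read off.
image₊∩image₋ : ∀ z → R₊.Image z → R₋.Image z → ∃ λ w → z ≡ scale w
image₊∩image₋ (a , b) (divides p p-eq) (divides q q-eq) =
  (a ℤ.+ (p ℤ.+ q) , b ℤ.- + 2 ℤ.* (p ℤ.- q)) , cong₂ _,_
    (≡.trans (a-eq a b) (≡.trans (cong₂ (λ x y → + 5 ℤ.* a ℤ.+ (x ℤ.+ y)) p-eq q-eq) (a-end a p q)))
    (≡.trans (b-eq a b) (≡.trans (cong₂ (λ x y → + 5 ℤ.* b ℤ.- + 2 ℤ.* (x ℤ.- y)) p-eq q-eq) (b-end b p q)))
  where
  a-eq : ∀ a b → a ≡ + 5 ℤ.* a ℤ.+ ((+ 1 ℤ.* b ℤ.- + 2 ℤ.* a) ℤ.+ (-[1+ 0 ] ℤ.* b ℤ.- + 2 ℤ.* a))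
  a-eq = solve-∀
  a-end : ∀ a p q → + 5 ℤ.* a ℤ.+ (p ℤ.* + 5 ℤ.+ q ℤ.* + 5) ≡ + 5 ℤ.* (a ℤ.+ (p ℤ.+ q))
  a-end = solve-∀
  b-eq : ∀ a b → b ≡ + 5 ℤ.* b ℤ.- + 2 ℤ.* ((+ 1 ℤ.* b ℤ.- + 2 ℤ.* a) ℤ.- (-[1+ 0 ] ℤ.* b ℤ.- + 2 ℤ.* a))
  b-eq = solve-∀
  b-end : ∀ b p q → + 5 ℤ.* b ℤ.- + 2 ℤ.* (p ℤ.* + 5 ℤ.- q ℤ.* + 5) ≡ + 5 ℤ.* (b ℤ.- + 2 ℤ.* (p ℤ.- q))
  b-end = solve-∀

scale-image₊ : ∀ w → R₊.Image (scale w)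
scale-image₊ (a , b) = divides (b ℤ.- + 2 ℤ.* a) (eq a b)
  where
  eq : ∀ a b → + 1 ℤ.* (+ 5 ℤ.* b) ℤ.- + 2 ℤ.* (+ 5 ℤ.* a) ≡ (b ℤ.- + 2 ℤ.* a) ℤ.* + 5
  eq = solve-∀

scale-image₋ : ∀ w → R₋.Image (scale w)
scale-image₋ (a , b) = divides (ℤ.- b ℤ.- + 2 ℤ.* a) (eq a b)
  where
  eq : ∀ a b → -[1+ 0 ] ℤ.* (+ 5 ℤ.* b) ℤ.- + 2 ℤ.* (+ 5 ℤ.* a) ≡ (ℤ.- b ℤ.- + 2 ℤ.* a) ℤ.* + 5
  eq = solve-∀

r₂ : ℕ → ℕ
r₂ n = count (λ z → norm z ℕ.≟ n) (squares n)

module _ (n : ℕ) where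
  private
    N : Decidable (λ z → norm z ≡ n * 5)
    N z = norm z ℕ.≟ n * 5

  Both : ℤ × ℤ → Set
  Both z = (norm z ≡ n * 5 × R₊.Image z) × (norm z ≡ n * 5 × R₋.Image z)

  both? : Decidable Both
  both? = (N ∩? R₊.image?) ∩? (N ∩? R₋.image?)

  -- Inclusion and exclusion for the two rotated copies of the points of norm n, which together
  -- cover the points of norm 5n. The overlap is evaluated separately as r₂(n/5).
  r₂-∪-∩ : r₂ n + r₂ n ≡ r₂ (n * 5) + count both? (squares (n * 5))
  r₂-∪-∩ = begin
    r₂ n + r₂ n
      ≡⟨ cong₂ _+_ (R₊.count-image n) (R₋.count-image n) ⟩
    count (N ∩? R₊.image?) zs + count (N ∩? R₋.image?) zs
      ≡⟨ count-∪-∩ (N ∩? R₊.image?) (N ∩? R₋.image?) zs ⟩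
    count ((N ∩? R₊.image?) ∪? (N ∩? R₋.image?)) zs + count both? zs
      ≡⟨ cong (_+ count both? zs) (count-≐ ((N ∩? R₊.image?) ∪? (N ∩? R₋.image?)) N
           (λ { (inj₁ (eq , _)) → eq ; (inj₂ (eq , _)) → eq }) (λ {z} → from z) zs) ⟩
    count N zs + count both? zs  ∎
    where
    open ≡.≡-Reasoning
    zs = squares (n * 5)
    from : ∀ z → norm z ≡ n * 5 →
      (norm z ≡ n * 5 × R₊.Image z) ⊎ (norm z ≡ n * 5 × R₋.Image z)
    from z eq with image₊∪image₋ z n eq
    ... | inj₁ im = inj₁ (eq , im)
    ... | inj₂ im = inj₂ (eq , im)

  both-scale : ∀ z → Both z → ∃ λ w → norm w * 5 ≡ n × z ≡ scale w
  both-scale z ((eq , im₊) , (_ , im₋)) with image₊∩image₋ z im₊ im₋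
  ... | w@(a , b) , ≡.refl = w
    , ℕ.*-cancelʳ-≡ (norm w * 5) n 5 (≡.trans (≡.sym (norm-scale a b)) eq) , ≡.refl

both-5∣ : ∀ n → count (both? (n * 5)) (squares (n * 5 * 5)) ≡ r₂ n
both-5∣ n = ≡.sym (count-bijection (λ z → norm z ℕ.≟ n) (both? (n * 5)) scale
  (λ eq → cong₂ _,_ (scale-injective (cong proj₁ eq)) (scale-injective (cong proj₂ eq)))
  (λ {z@(a , b)} → λ { ≡.refl → (norm-scale a b , scale-image₊ z) , (norm-scale a b , scale-image₋ z) })
  (λ {z} → surj z) (squares-unique n) (squares-unique (n * 5 * 5)) norm-∈ (norm-∈ ∘ proj₁ ∘ proj₁))
  where
  surj : ∀ z → Both (n * 5) z → ∃ λ w → norm w ≡ n × z ≡ scale w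
  surj z both with both-scale (n * 5) z both
  ... | w , eq , z≡ = w , ℕ.*-cancelʳ-≡ (norm w) n 5 eq , z≡

both-5∤ : ∀ r n → r < 4 → count (both? (suc r + n * 5)) (squares ((suc r + n * 5) * 5)) ≡ 0
both-5∤ r n r<4 = count-none (both? (suc r + n * 5)) none (squares ((suc r + n * 5) * 5))
  where
  none : ∀ z → ¬ Both (suc r + n * 5) z
  none z both with both-scale (suc r + n * 5) z both
  ... | w , eq , _ = r+n*5≢m*5 n (norm w) r<4 eq

-- r₂(5n) + r₂(n/5) = 2 r₂(n): the Hecke relation at the split prime 5 = (2 + i)(2 - i).
section₀-θ² : section 0 (θ ⊛ θ) ⊕ (θ ⊛ θ) ^ˢ 5 ≋ 2 ×ˢ (θ ⊛ θ)
section₀-θ² = pointwise λ n → begin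
  (θ ⊛ θ) (n * 5) + ((θ ⊛ θ) ^ˢ 5) n
    ≈⟨ +-cong₅ (𝔽.trans (θ²-count (n * 5)) (𝔽.*-congʳ {r₂ (n * 5)} (4^n*5 n))) (frobenius n) ⟩
  4 ^₅ n * r₂ (n * 5) + 4 ^₅ n * count (both? n) (squares (n * 5))
    ≡⟨ ℕ.*-distribˡ-+ (4 ^₅ n) (r₂ (n * 5)) _ ⟨
  4 ^₅ n * (r₂ (n * 5) + count (both? n) (squares (n * 5)))
    ≡⟨ cong (4 ^₅ n *_) (r₂-∪-∩ n) ⟨
  4 ^₅ n * (r₂ n + r₂ n)
    ≡⟨ ℕ.*-distribˡ-+ (4 ^₅ n) (r₂ n) (r₂ n) ⟩
  4 ^₅ n * r₂ n + 4 ^₅ n * r₂ n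
    ≈⟨ +-cong₅ (θ²-count n) (θ²-count n) ⟨
  (θ ⊛ θ) n + (θ ⊛ θ) n  ∎
  where
  open ≈₅-Reasoning
  frobenius : ∀ n → ((θ ⊛ θ) ^ˢ 5) n ≈₅ 4 ^₅ n * count (both? n) (squares (n * 5))
  frobenius n with split5 n
  ... | zero , m , _ , ≡.refl = begin
    ((θ ⊛ θ) ^ˢ 5) (m * 5)  ≈⟨ frobenius-5∣ (θ ⊛ θ) m ⟩
    (θ ⊛ θ) m               ≈⟨ θ²-count m ⟩
    4 ^₅ m * r₂ m           ≈⟨ *-cong₅ (4^n*5 m) (≡⇒≈₅ (both-5∣ m)) ⟨
    4 ^₅ (m * 5) * count (both? (m * 5)) (squares (m * 5 * 5))  ∎
  ... | suc r , m , s≤s r<4 , ≡.refl = 𝔽.trans (frobenius-5∤ (θ ⊛ θ) r m r<4)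
    (𝔽.sym (𝔽.trans (𝔽.*-congˡ {4 ^₅ (suc r + m * 5)} (≡⇒≈₅ (both-5∤ r m r<4))) (𝔽.zeroʳ (4 ^₅ (suc r + m * 5)))))

-- The operator U

U : Series → Series
U = section 0

U-cong : ∀ {f g} → f ≋ g → U f ≋ U g
U-cong = section-cong 0

-- Reads U f off an explicit dissection of f. Each power of θ then costs a single polynomial
-- identity for the solver, with the other four sections as witnesses.
U-interleave : ∀ {f} a b c d e →
  f ≋ 𝕊.0# ⊕ X ^ˢ 0 ⊛ a ^ˢ 5 ⊕ X ^ˢ 1 ⊛ b ^ˢ 5 ⊕ X ^ˢ 2 ⊛ c ^ˢ 5 ⊕ X ^ˢ 3 ⊛ d ^ˢ 5 ⊕ X ^ˢ 4 ⊛ e ^ˢ 5 →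
  U f ≋ a
U-interleave a b c d e f≋ = 𝕊.trans (U-cong f≋) (section-interleave 5 parts 0 ℕ.≤-refl (s≤s z≤n))
  where
  parts : ℕ → Series
  parts 0 = a
  parts 1 = b
  parts 2 = c
  parts 3 = d
  parts _ = e

private
  a b c p : Series
  a = U θ
  b = section 1 θ
  c = section 4 θ
  p = X ⊛ b ⊛ c

  open ≋-Reasoning
  open 𝕊-Solver

-- Squares are 0, 1 or 4 modulo 5, so the sections 2 and 3 vanish.
θ-dissection : θ ≋ a ^ˢ 5 ⊕ X ⊛ b ^ˢ 5 ⊕ X ^ˢ 4 ⊛ c ^ˢ 5
θ-dissection = begin
  θ
    ≈⟨ dissect θ ⟩
  𝕊.0# ⊕ X ^ˢ 0 ⊛ a ^ˢ 5 ⊕ X ^ˢ 1 ⊛ b ^ˢ 5 ⊕ X ^ˢ 2 ⊛ section 2 θ ^ˢ 5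
       ⊕ X ^ˢ 3 ⊛ section 3 θ ^ˢ 5 ⊕ X ^ˢ 4 ⊛ c ^ˢ 5
    ≈⟨ 𝕊.+-congʳ (𝕊.+-cong (𝕊.+-congˡ {𝕊.0# ⊕ X ^ˢ 0 ⊛ a ^ˢ 5 ⊕ X ^ˢ 1 ⊛ b ^ˢ 5}
         (𝕊.*-congˡ (^-congˡ 5 two))) (𝕊.*-congˡ (^-congˡ 5 three))) ⟩
  𝕊.0# ⊕ X ^ˢ 0 ⊛ a ^ˢ 5 ⊕ X ^ˢ 1 ⊛ b ^ˢ 5 ⊕ X ^ˢ 2 ⊛ 𝕊.0# ^ˢ 5
       ⊕ X ^ˢ 3 ⊛ 𝕊.0# ^ˢ 5 ⊕ X ^ˢ 4 ⊛ c ^ˢ 5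
    ≈⟨ solve 4 (λ x a b c →
         con 0 :+ x :^ 0 :* a :^ 5 :+ x :^ 1 :* b :^ 5 :+ x :^ 2 :* con 0 :^ 5
               :+ x :^ 3 :* con 0 :^ 5 :+ x :^ 4 :* c :^ 5
         := a :^ 5 :+ x :* b :^ 5 :+ x :^ 4 :* c :^ 5) 𝕊.refl X a b c ⟩
  a ^ˢ 5 ⊕ X ⊛ b ^ˢ 5 ⊕ X ^ˢ 4 ⊛ c ^ˢ 5  ∎
  where
  nonresidue : ∀ r → r ≡ 2 ⊎ r ≡ 3 → ∀ i → i < 5 → ¬ i * i ≈₅ r
  nonresidue _ (inj₁ ≡.refl) 0 _ (mod5 ())
  nonresidue _ (inj₁ ≡.refl) 1 _ (mod5 ())
  nonresidue _ (inj₁ ≡.refl) 2 _ (mod5 ())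
  nonresidue _ (inj₁ ≡.refl) 3 _ (mod5 ())
  nonresidue _ (inj₁ ≡.refl) 4 _ (mod5 ())
  nonresidue _ (inj₂ ≡.refl) 0 _ (mod5 ())
  nonresidue _ (inj₂ ≡.refl) 1 _ (mod5 ())
  nonresidue _ (inj₂ ≡.refl) 2 _ (mod5 ())
  nonresidue _ (inj₂ ≡.refl) 3 _ (mod5 ())
  nonresidue _ (inj₂ ≡.refl) 4 _ (mod5 ())
  nonresidue _ _ (suc (suc (suc (suc (suc _))))) (s≤s (s≤s (s≤s (s≤s (s≤s ()))))) _
  two : section 2 θ ≋ 𝕊.0#
  two = section-θ-nonresidue 2 (nonresidue 2 (inj₁ ≡.refl))
  three : section 3 θ ≋ 𝕊.0#
  three = section-θ-nonresidue 3 (nonresidue 3 (inj₂ ≡.refl))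

U-θ² : U (θ ⊛ θ) ≋ a ⊛ a ⊕ 2 ×ˢ p
U-θ² = U-interleave (a ⊛ a ⊕ 2 ×ˢ p) (2 ×ˢ (a ⊛ b)) (b ⊛ b) (X ⊛ (c ⊛ c)) (2 ×ˢ (a ⊛ c))
  (𝕊.trans (𝕊.*-cong θ-dissection θ-dissection)
    (solve 4 (λ x a b c →
      let t = a :^ 5 :+ x :* b :^ 5 :+ x :^ 4 :* c :^ 5
          p = x :* b :* c
      in t :* t := con 0 :+ x :^ 0 :* (a :* a :+ (p :+ p)) :^ 5 :+ x :^ 1 :* (a :* b :+ a :* b) :^ 5
                   :+ x :^ 2 :* (b :* b) :^ 5 :+ x :^ 3 :* (x :* (c :* c)) :^ 5
                   :+ x :^ 4 :* (a :* c :+ a :* c) :^ 5)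
      𝕊.refl X a b c))

-- Because U θ^2 = a^2 + 2p and (θ^2)^5 = a^2, the Hecke relation reads 2 (a^2 + p) = 2 θ^2. The
-- factor 3 inverts 2 modulo 5.
Xbc≋θ²-a² : p ≋ θ ^ˢ 2 ⊕ 4 ×ˢ a ^ˢ 2
Xbc≋θ²-a² = begin
  p
    ≈⟨ solve 2 (λ a p → p := con 3 :* ((a :* a :+ (p :+ p)) :+ a :^ 2) :+ con 4 :* a :^ 2) 𝕊.refl a p ⟩
  3 ×ˢ 𝕊.1# ⊛ ((a ⊛ a ⊕ 2 ×ˢ p) ⊕ a ^ˢ 2) ⊕ 4 ×ˢ 𝕊.1# ⊛ a ^ˢ 2
    ≈⟨ 𝕊.+-congʳ (𝕊.*-congˡ hecke) ⟩
  3 ×ˢ 𝕊.1# ⊛ (2 ×ˢ (θ ⊛ θ)) ⊕ 4 ×ˢ 𝕊.1# ⊛ a ^ˢ 2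
    ≈⟨ solve 2 (λ a t → con 3 :* (t :* t :+ t :* t) :+ con 4 :* a :^ 2
         := t :^ 2 :+ (a :^ 2 :+ a :^ 2 :+ a :^ 2 :+ a :^ 2)) 𝕊.refl a θ ⟩
  θ ^ˢ 2 ⊕ 4 ×ˢ a ^ˢ 2  ∎
  where
  hecke : (a ⊛ a ⊕ 2 ×ˢ p) ⊕ a ^ˢ 2 ≋ 2 ×ˢ (θ ⊛ θ)
  hecke = begin
    (a ⊛ a ⊕ 2 ×ˢ p) ⊕ a ^ˢ 2            ≈⟨ 𝕊.+-cong (𝕊.sym U-θ²) (^-congˡ 2 section₀-θ) ⟩
    U (θ ⊛ θ) ⊕ (θ ^ˢ 5) ^ˢ 2            ≈⟨ 𝕊.+-congˡ {U (θ ⊛ θ)}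
                                              (solve 1 (λ t → (t :^ 5) :^ 2 := (t :* t) :^ 5) 𝕊.refl θ) ⟩
    U (θ ⊛ θ) ⊕ (θ ⊛ θ) ^ˢ 5             ≈⟨ section₀-θ² ⟩
    2 ×ˢ (θ ⊛ θ)                         ∎

-- The multinomial coefficient 6 is 1 modulo 5, which leaves a^3 + a p = a (a^2 + p) = a θ^2.
U-θ³ : U (θ ^ˢ 3) ≋ θ ^ˢ 5 ⊛ (θ ⊛ θ)
U-θ³ = begin
  U (θ ^ˢ 3)
    ≈⟨ U-interleave _ _ _ _ _ (𝕊.trans (^-congˡ 3 θ-dissection) (solve 4 (λ x a b c →
         (a :^ 5 :+ x :* b :^ 5 :+ x :^ 4 :* c :^ 5) :^ 3
         := con 0 :+ x :^ 0 :* (a :^ 3 :+ a :* (x :* b :* c)) :^ 5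
              :+ x :^ 1 :* (con 3 :* a :^ 2 :* b :+ con 3 :* x :* b :^ 2 :* c) :^ 5
              :+ x :^ 2 :* (con 3 :* a :* b :^ 2 :+ x :^ 2 :* c :^ 3) :^ 5
              :+ x :^ 3 :* (b :^ 3 :+ con 3 :* x :* a :* c :^ 2) :^ 5
              :+ x :^ 4 :* (con 3 :* a :^ 2 :* c :+ con 3 :* x :* b :* c :^ 2) :^ 5)
         𝕊.refl X a b c)) ⟩
  a ^ˢ 3 ⊕ a ⊛ p
    ≈⟨ 𝕊.+-congˡ {a ^ˢ 3} (𝕊.*-congˡ Xbc≋θ²-a²) ⟩
  a ^ˢ 3 ⊕ a ⊛ (θ ^ˢ 2 ⊕ 4 ×ˢ a ^ˢ 2)
    ≈⟨ solve 2 (λ a t → a :^ 3 :+ a :* (t :^ 2 :+ (a :^ 2 :+ a :^ 2 :+ a :^ 2 :+ a :^ 2))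
         := a :* (t :* t)) 𝕊.refl a θ ⟩
  a ⊛ (θ ⊛ θ)
    ≈⟨ 𝕊.*-congʳ section₀-θ ⟩
  θ ^ˢ 5 ⊛ (θ ⊛ θ)  ∎

-- The multinomial coefficients 12 and 6 are 2 and 1 modulo 5, so the zeroth section is the perfect
-- square (a^2 + p)^2.
U-θ⁴ : U (θ ^ˢ 4) ≋ θ ^ˢ 4
U-θ⁴ = begin
  U (θ ^ˢ 4)
    ≈⟨ U-interleave _ _ _ _ _ (𝕊.trans (^-congˡ 4 θ-dissection) (solve 4 (λ x a b c →
         (a :^ 5 :+ x :* b :^ 5 :+ x :^ 4 :* c :^ 5) :^ 4
         := con 0 :+ x :^ 0 :* (a :^ 4 :+ con 2 :* a :^ 2 :* (x :* b :* c) :+ (x :* b :* c) :^ 2) :^ 5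
              :+ x :^ 1 :* (con 4 :* a :^ 3 :* b :+ con 2 :* x :* a :* b :^ 2 :* c :+ x :^ 3 :* c :^ 4) :^ 5
              :+ x :^ 2 :* (a :^ 2 :* b :^ 2 :+ con 4 :* x :^ 2 :* a :* c :^ 3 :+ con 4 :* x :* b :^ 3 :* c) :^ 5
              :+ x :^ 3 :* (con 4 :* a :* b :^ 3 :+ x :* a :^ 2 :* c :^ 2 :+ con 4 :* x :^ 2 :* b :* c :^ 3) :^ 5
              :+ x :^ 4 :* (b :^ 4 :+ con 4 :* a :^ 3 :* c :+ con 2 :* x :* a :* b :* c :^ 2) :^ 5)
         𝕊.refl X a b c)) ⟩
  a ^ˢ 4 ⊕ 2 ×ˢ 𝕊.1# ⊛ a ^ˢ 2 ⊛ p ⊕ p ^ˢ 2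
    ≈⟨ 𝕊.+-cong (𝕊.+-congˡ {a ^ˢ 4} (𝕊.*-congˡ Xbc≋θ²-a²)) (^-congˡ 2 Xbc≋θ²-a²) ⟩
  a ^ˢ 4 ⊕ 2 ×ˢ 𝕊.1# ⊛ a ^ˢ 2 ⊛ (θ ^ˢ 2 ⊕ 4 ×ˢ a ^ˢ 2) ⊕ (θ ^ˢ 2 ⊕ 4 ×ˢ a ^ˢ 2) ^ˢ 2
    ≈⟨ solve 2 (λ a t → let p = t :^ 2 :+ (a :^ 2 :+ a :^ 2 :+ a :^ 2 :+ a :^ 2) in
         a :^ 4 :+ con 2 :* a :^ 2 :* p :+ p :^ 2 := t :^ 4) 𝕊.refl a θ ⟩
  θ ^ˢ 4  ∎

-- Successive images of θ^3 are θ^7, then θ U θ^2 = 2 θ^3 - θ^11, then 2 θ^7 - θ^7. The term -θ^10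
-- is written as the fifth power of -θ^2, so that it leaves U as -θ^2.
U³-θ³ : U (U (U (θ ^ˢ 3))) ≋ U (θ ^ˢ 3)
U³-θ³ = begin
  U (U (U (θ ^ˢ 3)))
    ≈⟨ U-cong (U-cong U-θ³) ⟩
  U (U (θ ^ˢ 5 ⊛ (θ ⊛ θ)))
    ≈⟨ U-cong (section-frobenius-⊛ θ (θ ⊛ θ)) ⟩
  U (θ ⊛ U (θ ⊛ θ))
    ≈⟨ U-cong split ⟩
  U (θ ^ˢ 3) ⊕ U (θ ^ˢ 3) ⊕ U ((ν ⊛ θ ^ˢ 2) ^ˢ 5 ⊛ θ)
    ≈⟨ 𝕊.+-cong (𝕊.+-cong U-θ³ U-θ³)
         (𝕊.trans (section-frobenius-⊛ (ν ⊛ θ ^ˢ 2) θ) (𝕊.*-congˡ section₀-θ)) ⟩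
  θ ^ˢ 5 ⊛ (θ ⊛ θ) ⊕ θ ^ˢ 5 ⊛ (θ ⊛ θ) ⊕ (ν ⊛ θ ^ˢ 2) ⊛ θ ^ˢ 5
    ≈⟨ solve 1 (λ t → t :^ 5 :* (t :* t) :+ t :^ 5 :* (t :* t) :+ (con 4 :* t :^ 2) :* t :^ 5
         := t :^ 5 :* (t :* t)) 𝕊.refl θ ⟩
  θ ^ˢ 5 ⊛ (θ ⊛ θ)
    ≈⟨ U-θ³ ⟨
  U (θ ^ˢ 3)  ∎
  where
  u = U (θ ⊛ θ)
  split : θ ⊛ u ≋ θ ^ˢ 3 ⊕ θ ^ˢ 3 ⊕ (ν ⊛ θ ^ˢ 2) ^ˢ 5 ⊛ θ
  split = begin
    θ ⊛ u
      ≈⟨ solve 2 (λ t u → t :* u := t :* (u :+ (t :* t) :^ 5) :+ (con 4 :* t :^ 2) :^ 5 :* t) 𝕊.refl θ u ⟩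
    θ ⊛ (u ⊕ (θ ⊛ θ) ^ˢ 5) ⊕ (ν ⊛ θ ^ˢ 2) ^ˢ 5 ⊛ θ
      ≈⟨ 𝕊.+-congʳ (𝕊.*-congˡ section₀-θ²) ⟩
    θ ⊛ (2 ×ˢ (θ ⊛ θ)) ⊕ (ν ⊛ θ ^ˢ 2) ^ˢ 5 ⊛ θ
      ≈⟨ solve 1 (λ t → t :* (t :* t :+ t :* t) :+ (con 4 :* t :^ 2) :^ 5 :* t
           := t :^ 3 :+ t :^ 3 :+ (con 4 :* t :^ 2) :^ 5 :* t) 𝕊.refl θ ⟩
    θ ^ˢ 3 ⊕ θ ^ˢ 3 ⊕ (ν ⊛ θ ^ˢ 2) ^ˢ 5 ⊛ θ  ∎

-- Iterates of U on the generating functions for ℓ = 5^α.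

F : ℕ → Series
F α = overpartitions (5 ^ α)

F⊛θ : ∀ α → F α ⊛ θ ≋ θ ^ˢ (5 ^ α)
F⊛θ α = overpartitions⊛θ (5 ^ α) {{ℕ.m^n≢0 5 α}} (frobenius-5^ α)

U-power-⊛ : ∀ α f → U (θ ^ˢ (5 ^ suc α) ⊛ f) ≋ θ ^ˢ (5 ^ α) ⊛ U f
U-power-⊛ α f = 𝕊.trans
  (U-cong (𝕊.*-congʳ (𝕊.trans (^-congʳ θ (ℕ.*-comm 5 (5 ^ α))) (𝕊.sym (^-assocʳ θ (5 ^ α) 5)))))
  (section-frobenius-⊛ (θ ^ˢ (5 ^ α)) f)

-- A factor θ outside U becomes θ^5 inside, where F θ^5 = (F θ) θ^4 has no denominator; θ is
-- cancelled at the end.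
U-F : ∀ α → U (F (suc α)) ≋ θ ^ˢ (5 ^ α) ⊛ θ ^ˢ 3
U-F α = pointwise λ n → ⊛-cancelˡ[] θ n ≡.refl (≋⇒≋[] times-θ) n ℕ.≤-refl
  where
  w = θ ^ˢ (5 ^ α)
  times-θ : θ ⊛ U (F (suc α)) ≋ θ ⊛ (w ⊛ θ ^ˢ 3)
  times-θ = begin
    θ ⊛ U (F (suc α))            ≈⟨ section-frobenius-⊛ θ (F (suc α)) ⟨
    U (θ ^ˢ 5 ⊛ F (suc α))       ≈⟨ U-cong (solve 2 (λ t f → t :^ 5 :* f := (f :* t) :* t :^ 4) 𝕊.refl
                                              θ (F (suc α))) ⟩
    U ((F (suc α) ⊛ θ) ⊛ θ ^ˢ 4) ≈⟨ U-cong (𝕊.*-congʳ (F⊛θ (suc α))) ⟩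
    U (θ ^ˢ (5 ^ suc α) ⊛ θ ^ˢ 4) ≈⟨ U-power-⊛ α (θ ^ˢ 4) ⟩
    w ⊛ U (θ ^ˢ 4)               ≈⟨ 𝕊.*-congˡ U-θ⁴ ⟩
    w ⊛ θ ^ˢ 4                   ≈⟨ solve 2 (λ t w → w :* t :^ 4 := t :* (w :* t :^ 3)) 𝕊.refl θ w ⟩
    θ ⊛ (w ⊛ θ ^ˢ 3)             ∎

U²-F : ∀ α → U (U (F (2 + α))) ≋ θ ^ˢ (5 ^ α) ⊛ U (θ ^ˢ 3)
U²-F α = 𝕊.trans (U-cong (U-F (suc α))) (U-power-⊛ α (θ ^ˢ 3))

U⁴-F : ∀ α → U (U (U (U (F (4 + α))))) ≋ U (U (F (2 + α)))
U⁴-F α = begin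
  U (U (U (U (F (4 + α)))))                        ≈⟨ U-cong (U-cong (U²-F (2 + α))) ⟩
  U (U (θ ^ˢ (5 ^ (2 + α)) ⊛ U (θ ^ˢ 3)))          ≈⟨ U-cong (U-power-⊛ (suc α) (U (θ ^ˢ 3))) ⟩
  U (θ ^ˢ (5 ^ suc α) ⊛ U (U (θ ^ˢ 3)))            ≈⟨ U-power-⊛ α (U (U (θ ^ˢ 3))) ⟩
  θ ^ˢ (5 ^ α) ⊛ U (U (U (θ ^ˢ 3)))                ≈⟨ 𝕊.*-congˡ U³-θ³ ⟩
  θ ^ˢ (5 ^ α) ⊛ U (θ ^ˢ 3)                        ≈⟨ U²-F α ⟨
  U (U (F (2 + α)))                                ∎

theorem10 : (n α : ℕ) → 2 ≤ α →
    Abar (5 ^ α) (25 * n) % 5 ≡ Abar (5 ^ (α + 2)) (625 * n) % 5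
theorem10 n α@(suc (suc β)) (s≤s (s≤s z≤n)) =
  ≡.trans (cong (λ k → Abar (5 ^ α) k % 5) 25n)
  (≡.trans (≡.sym (_≈₅_.%5≡ (at (U⁴-F β) n)))
  (cong₂ (λ k m → Abar (5 ^ k) m % 5) (ℕ.+-comm 2 α) (≡.sym 625n)))
  where
  25n : 25 * n ≡ n * 5 * 5
  25n = ≡.trans (ℕ.*-comm 25 n) (≡.sym (ℕ.*-assoc n 5 5))
  625n : 625 * n ≡ n * 5 * 5 * 5 * 5
  625n = ≡.trans (ℕ.*-comm 625 n) (≡.trans (≡.sym (ℕ.*-assoc n 125 5)) (cong (_* 5)
    (≡.trans (≡.sym (ℕ.*-assoc n 25 5)) (cong (_* 5) (≡.sym (ℕ.*-assoc n 5 5))))))
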